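{- Let $G$ be an instance of the rank-maximal matchings problem (with last-resort posts added) and $M$ a rank-maximal matching in $G$. Then every rank-maximal matching $M'$ in $G$ can be obtained from $M$ by applying to $M$ a collection of pairwise vertex-disjoint switching paths and switching cycles of the switching graph $G_M$.
   Context: An instance of the rank-maximal matchings problem is a bipartite graph $G=(\mathcal{A}\cup\mathcal{P},E)$, where $\mathcal{A}$ is a set of applicants, $\mathcal{P}$ a set of posts, and $E=E_1\cup\dots\cup E_r$ is a disjoint union; $(a,p)\in E_i$ means $p$ is an $i$-th choice of $a$, written $\mathrm{rank}(a,p)=i$ (ties allowed). For each applicant $a$ a new dummy post $\ell(a)$ is added with $\mathrm{rank}(a,\ell(a))=r+1$; $E_{r+1}$ is the set of these edges and the resulting instance is again called $G$. The signature of a matching $M$ is $(x_1,\dots,x_{r+1})$, $x_i$ the number of applicants matched to a post of rank $i$; signatures are compared lexicographically and $M$ is rank-maximal if its signature is maximum. For a bipartite graph $H$ with maximum matching $N$, a vertex is even (resp. odd) if there is an even (resp. odd) length alternating path w.r.t. $N$ from an $N$-unmatched vertex to it, and unreachable otherwise (independent of the choice of $N$). Reduced graphs: $G'_1=(\mathcal{A}\cup\mathcal{P},E_1)$. For $i=1,\dots,r$: let $\mathcal{E}_i,\mathcal{O}_i,\mathcal{U}_i$ be the even, odd, unreachable vertices of $G'_i$; discard all edges of $E_j$, $j>i$, incident to $\mathcal{O}_i\cup\mathcal{U}_i$; delete from $G'_i$ every edge joining $\mathcal{O}_i$ to $\mathcal{O}_i\cup\mathcal{U}_i$; add the remaining edges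 of $E_{i+1}$ to get $G'_{i+1}$. $\mathcal{E}_{r+1},\mathcal{O}_{r+1},\mathcal{U}_{r+1}$ are the even, odd, unreachable vertices of $G'_{r+1}$, and the reduced graph $G'$ is $G'_{r+1}$ minus all edges joining $\mathcal{O}_{r+1}$ to $\mathcal{O}_{r+1}\cup\mathcal{U}_{r+1}$. Switching graph: $G_M$ is the directed weighted graph on vertex set $\mathcal{P}$ with an edge $(p_i,p_j)$ whenever some applicant $a$ has $(a,p_i)\in M$ and $(a,p_j)\in G'$, of weight $\mathrm{rank}(a,p_j)-\mathrm{rank}(a,p_i)$. A sink vertex is a vertex of $G_M$ with no outgoing edge lying in $\mathcal{E}_1\cap\dots\cap\mathcal{E}_{r+1}$. A switching path is a directed path $T=\langle p_0,\dots,p_{k-1}\rangle$ in $G_M$ ending in a sink vertex with total weight $0$; a switching cycle is a directed cycle $\langle p_0,\dots,p_{k-1},p_0\rangle$ in $G_M$ of total weight $0$. Applying a switching path $T$ to $M$: with $a_i=M(p_i)$ for $0\le i\le k-2$, $M\cdot T$ matches $a_i$ to $p_{i+1}$ and leaves all other applicants' partners unchanged; applying a switching cycle is analogous (each $M(p_i)$ moves to $p_{i+1}$, indices mod $k$). -}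

module Defs where

open import Data.Nat using (ℕ; zero; suc; _≤_; _<_; _%_; _≡ᵇ_)
open import Data.Integer as ℤ using (ℤ; +_; _-_)
open import Data.Fin using (Fin; _≟_)
open import Data.Sum using (_⊎_; inj₁; inj₂)
open import Data.Product using (Σ; ∃; ∃-syntax; _×_; _,_)
open import Data.Maybe using (Maybe; just; nothing; fromMaybe)
open import Data.List using (List; []; _∷_; _++_; length; map; [_]; allFin)
open import Data.Nat.ListAction using (sum)
open import Data.List.Membership.Propositional using (_∈_; _∉_)
open import Data.List.Relation.Unary.Unique.Propositional using (Unique)
open import Data.Bool using (Bool; true; false; not; if_then_else_)
open import Data.Empty using (⊥)
open import Relation.Nullary using (¬_; yes; no)
open import Relation.Binary.PropositionalEquality using (_≡_; _≢_)

-- An instance of the rank-maximal matchings problem.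
-- Applicants are Fin nA, (original) posts are Fin nP.
-- rk a p ≡ just i  means  (a , p) ∈ E_i  (p is an i-th choice of a);
-- rk a p ≡ nothing means  (a , p) is not an edge.  Using a (partial)
-- function makes E_1 , … , E_r automatically pairwise disjoint.
-- Ranks lie in 1 … r.
record Instance : Set where
  field
    nA nP r  : ℕ
    rk       : Fin nA → Fin nP → Maybe ℕ
    rk-range : ∀ a p i → rk a p ≡ just i → 1 ≤ i × i ≤ r

module Inst (G : Instance) where
  open Instance G public

  Applicant : Set
  Applicant = Fin nA

  -- posts of the instance with last-resort posts added:
  -- inj₁ p is an original post, inj₂ a is the last-resort post ℓ(a)
  Post : Set
  Post = Fin nP ⊎ Fin nA

  Vertex : Set
  Vertex = Applicant ⊎ Post

  rank : Applicant → Post → Maybe ℕ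
  rank a (inj₁ p) = rk a p
  rank a (inj₂ b) with a ≟ b
  ... | yes _ = just (suc r)
  ... | no  _ = nothing

  EdgeSet : Set₁
  EdgeSet = Applicant → Post → Set

  E : ℕ → EdgeSet
  E i a p = rank a p ≡ just i

  EdgesG : EdgeSet
  EdgesG a p = ∃[ i ] E i a p

  Assignment : Set
  Assignment = Applicant → Maybe Post

  IsMatchingIn : EdgeSet → Assignment → Set
  IsMatchingIn H N =
    (∀ a p → N a ≡ just p → H a p) ×
    (∀ a b p → N a ≡ just p → N b ≡ just p → a ≡ b)

  count : (Applicant → ℕ) → ℕ
  count f = sum (map f (allFin nA))

  isMatched : Maybe Post → ℕ
  isMatched (just _) = 1
  isMatched nothing  = 0

  size : Assignment → ℕ
  size N = count (λ a → isMatched (N a))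

  rankHit : ℕ → Maybe ℕ → ℕ
  rankHit i (just j) = if i ≡ᵇ j then 1 else 0
  rankHit i nothing  = 0

  hit : ℕ → Applicant → Maybe Post → ℕ
  hit i a (just p) = rankHit i (rank a p)
  hit i a nothing  = 0

  sig : Assignment → ℕ → ℕ
  sig N i = count (λ a → hit i a (N a))

  LexLess : (ℕ → ℕ) → (ℕ → ℕ) → Set
  LexLess s t = ∃[ i ] (1 ≤ i × i ≤ suc r ×
                        (∀ j → 1 ≤ j → j < i → s j ≡ t j) × s i < t i)

  RankMaximal : Assignment → Set
  RankMaximal M = IsMatchingIn EdgesG M ×
                  (∀ N → IsMatchingIn EdgesG N → ¬ LexLess (sig M) (sig N))

  MaxMatching : EdgeSet → Assignment → Set
  MaxMatching H N = IsMatchingIn H N × (∀ N' → IsMatchingIn H N' → size N' ≤ size N)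

  Adj : EdgeSet → Vertex → Vertex → Set
  Adj H (inj₁ a) (inj₂ p) = H a p
  Adj H (inj₂ p) (inj₁ a) = H a p
  Adj H _        _        = ⊥

  InM : Assignment → Vertex → Vertex → Set
  InM N (inj₁ a) (inj₂ p) = N a ≡ just p
  InM N (inj₂ p) (inj₁ a) = N a ≡ just p
  InM N _        _        = ⊥

  Unmatched : Assignment → Vertex → Set
  Unmatched N (inj₁ a) = N a ≡ nothing
  Unmatched N (inj₂ p) = ∀ a → N a ≢ just p

  IfB : Bool → Set → Set
  IfB true  X = X
  IfB false X = ¬ X

  data AltSteps (H : EdgeSet) (N : Assignment) : Bool → Vertex → List Vertex → Set where
    done : ∀ {b v} → AltSteps H N b v []
    step : ∀ {b v w ws} → Adj H v w → IfB b (InM N v w) →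
           AltSteps H N (not b) w ws → AltSteps H N b v (w ∷ ws)

  endpoint : {X : Set} → X → List X → X
  endpoint v []       = v
  endpoint v (w ∷ ws) = endpoint w ws

  AltPathTo : EdgeSet → Assignment → ℕ → Vertex → Set
  AltPathTo H N par v =
    ∃[ v₀ ] ∃[ ws ] (Unmatched N v₀ × AltSteps H N false v₀ ws ×
                     Unique (v₀ ∷ ws) × endpoint v₀ ws ≡ v × length ws % 2 ≡ par)

  EvenV : EdgeSet → Vertex → Set
  EvenV H v = ∃[ N ] (MaxMatching H N × AltPathTo H N 0 v)

  OddV : EdgeSet → Vertex → Set
  OddV H v = ∃[ N ] (MaxMatching H N × AltPathTo H N 1 v)

  UnreachV : EdgeSet → Vertex → Set
  UnreachV H v = ¬ EvenV H v × ¬ OddV H v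

  OU : EdgeSet → Vertex → Set
  OU H v = OddV H v ⊎ UnreachV H v

  Del : EdgeSet → Applicant → Post → Set
  Del H a p = (OddV H (inj₁ a) × OU H (inj₂ p)) ⊎ (OU H (inj₁ a) × OddV H (inj₂ p))

  -- reduced graphs:  Gr n = G'_{n+1}
  -- Alive n v : v ∉ O_k ∪ U_k for all k = 1 … n+1
  Gr    : ℕ → EdgeSet
  Alive : ℕ → Vertex → Set
  Gr zero    a p = E 1 a p
  Gr (suc n) a p = (Gr n a p × ¬ Del (Gr n) a p) ⊎
                   (E (suc (suc n)) a p × Alive n (inj₁ a) × Alive n (inj₂ p))
  Alive zero    v = ¬ OU (Gr zero) v
  Alive (suc n) v = Alive n v × ¬ OU (Gr (suc n)) v

  Reduced : EdgeSet
  Reduced a p = Gr r a p × ¬ Del (Gr r) a p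

  EvenAll : Vertex → Set
  EvenAll v = ∀ k → k ≤ r → EvenV (Gr k) v

  rkZ : Applicant → Post → ℤ
  rkZ a p = + fromMaybe 0 (rank a p)

  SwEdge : Assignment → Post → Post → ℤ → Set
  SwEdge M p q w = ∃[ a ] (M a ≡ just p × Reduced a q × w ≡ rkZ a q - rkZ a p)

  Sink : Assignment → Post → Set
  Sink M p = (¬ (∃[ q ] ∃[ w ] SwEdge M p q w)) × EvenAll (inj₂ p)

  data WPath (M : Assignment) : List Post → ℤ → Set where
    single : ∀ {p} → WPath M (p ∷ []) (+ 0)
    cons   : ∀ {p q ps w w'} → SwEdge M p q w → WPath M (q ∷ ps) w' →
             WPath M (p ∷ q ∷ ps) (w ℤ.+ w')

  -- a switching path ⟨ps⟩ or a switching cycle ⟨p , rest … , p⟩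
  data Switch : Set where
    path  : List Post → Switch
    cycle : Post → List Post → Switch

  verts : Switch → List Post
  verts (path ps)    = ps
  verts (cycle p ps) = p ∷ ps

  trace : Switch → List Post
  trace (path ps)    = ps
  trace (cycle p ps) = p ∷ (ps ++ [ p ])

  IsSwitching : Assignment → Switch → Set
  IsSwitching M (path ps) =
    ∃[ p₀ ] ∃[ rest ] (ps ≡ p₀ ∷ rest × Unique ps × WPath M ps (+ 0) ×
                       Sink M (endpoint p₀ rest))
  IsSwitching M (cycle p₀ rest) =
    Unique (p₀ ∷ rest) × WPath M (p₀ ∷ (rest ++ [ p₀ ])) (+ 0)

  VertexDisjoint : Switch → Switch → Set
  VertexDisjoint S T = ∀ p → p ∈ verts S → p ∉ verts T

  Consec : List Post → Post → Post → Set
  Consec xs p q = ∃[ ys ] ∃[ zs ] xs ≡ ys ++ (p ∷ q ∷ zs)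

  Applied : Assignment → List Switch → Assignment → Set
  Applied M Ts M' = ∀ a →
    (∃[ T ] ∃[ p ] ∃[ q ] (T ∈ Ts × M a ≡ just p × Consec (trace T) p q × M' a ≡ just q))
    ⊎ ((∀ T p q → T ∈ Ts → M a ≡ just p → ¬ Consec (trace T) p q) × M' a ≡ M a)

-- Let Mₖ be the part of a rank-maximal M of rank at most k.  By induction on
-- k, Mₖ is a maximum matching of G′ₖ: otherwise augment Mₖ in G′ₖ; the result
-- covers all vertices covered by Mₖ and uses no deleted edges, so for every
-- j < k its part of rank at most j is still maximum in G′ⱼ, and its signature
-- beats that of M.  Hence M lies in G′, and a post left unmatched by M is
-- even in every G′ₖ, i.e. it is a sink.
-- For rank-maximal M and M′, the partial injection M(a) ↦ M′(a) on posts
-- decomposes into chains, ending in posts unmatched by M, and cycles.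
-- Exchanging M and M′ along one of them yields two matchings whose signatures
-- sum to sig M + sig M′; as neither beats the maximum, both equal it, so the
-- chain or cycle has weight 0.

module Submission where

open import Defs
open import Data.Nat using (ℕ; zero; suc; _+_; _*_; _≤_; _<_; z≤n; s≤s; _%_; _≡ᵇ_; _≤ᵇ_; s≤s⁻¹)
open import Data.Nat.Properties
open import Data.Nat.Induction using (<-rec)
open import Data.Nat.ListAction using (sum)
import Data.Integer as ℤ
open ℤ using (ℤ)
open import Data.Fin as Fin using (Fin)
open import Data.Fin.Properties using (any?)
open import Data.Bool using (if_then_else_; Bool; true; false; not)
open import Data.Bool.Properties using (not-¬; not-involutive)
open import Data.Sum using (_⊎_; inj₁; inj₂; [_,_]′)
import Data.Sum.Properties as Sum
open import Data.Product using (∃-syntax; _×_; _,_; proj₁; proj₂)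
open import Data.Maybe using (Maybe; just; nothing; fromMaybe)
import Data.Maybe.Properties as Maybe
open import Data.List using (List; []; _∷_; _++_; length; map; [_]; allFin; filter)
open import Data.List.Properties using (length-map; length-++; ++-assoc; map-cong)
open import Data.List.Membership.Propositional using (_∈_; _∉_; find; lose)
open import Data.List.Membership.DecPropositional using (_∈?_)
open import Data.List.Membership.Propositional.Properties using (∈-∃++; ∈-++⁺ˡ; ∈-++⁺ʳ; ∈-++⁻; ∈-map⁻; ∈-map⁺; ∈-filter⁺; ∈-filter⁻; ∈-allFin)
open import Data.List.Relation.Unary.Any as Any using (here; there)
open import Data.List.Relation.Unary.All as All using (All; []; _∷_)
import Data.List.Relation.Unary.All.Properties as All
open import Data.List.Relation.Unary.AllPairs using (AllPairs; []; _∷_)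
open import Data.List.Relation.Unary.Unique.Propositional using (Unique)
import Data.List.Relation.Unary.Unique.Propositional.Properties as Unique
open import Data.List.Relation.Unary.Linked using (Linked; []; [-]; _∷_)
import Data.Integer.Properties as ℤ
open import Data.Vec.Functional using (updateAt)
open import Data.Vec.Functional.Properties using (updateAt-updates; updateAt-minimal)
open import Data.Empty using (⊥-elim)
open import Function using (_∘_; const; id; case_of_)
open import Relation.Nullary using (¬_; Dec; does; yes; no; contradiction; ¬?)
open import Relation.Nullary.Decidable using (¬¬-excluded-middle; decidable-stable; _×-dec_; dec-true; dec-false)
open import Algebra.Properties.CommutativeSemigroup +-commutativeSemigroup using () renaming (interchange to +-interchange)
open import Algebra.Properties.CommutativeSemigroup ℤ.+-commutativeSemigroup using () renaming (interchange to ℤ-interchange)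
open import Relation.Binary.Definitions using (tri<; tri≈; tri>)
open import Relation.Unary using (Decidable)
open import Relation.Binary.PropositionalEquality hiding ([_])

-- Evenness asserts an alternating path for some maximum matching; that it does not depend on this
-- matching has to be proved, and it is not decidable as it stands. One device meets both obstacles:
-- a König cover (`Barrier`) belonging to one maximum matching belongs to every other (`transfer`).
-- The counting behind this must decide membership in the set that defines the cover, which is
-- possible under a double negation only. That suffices, since the conclusions drawn are negations
-- or inequalities between numbers. For the exchange, sending M(a) to M′(a) makes sense for all
-- applicants only because rank-maximal matchings leave none unmatched; the last-resort posts ensure
-- this. Equal signatures give weight zero because the sum of all ranks is a function of the
-- signature.

-- Counting in duplicate-free lists and finite sums

Unique-⊆⇒length-≤ : ∀ {A : Set} {xs ys : List A} → Unique xs → (∀ {x} → x ∈ xs → x ∈ ys) →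
                    length xs ≤ length ys
Unique-⊆⇒length-≤ [] sub = z≤n
Unique-⊆⇒length-≤ {xs = x ∷ xs} (x∉ ∷ u) sub with ∈-∃++ (sub (here refl))
... | as , bs , refl = ≤-trans (s≤s (Unique-⊆⇒length-≤ u sub′))
    (≤-reflexive (trans (cong suc (length-++ as)) (sym (trans (length-++ as) (+-suc _ _)))))
  where
  sub′ : ∀ {y} → y ∈ xs → y ∈ as ++ bs
  sub′ y∈ with ∈-++⁻ as (sub (there y∈))
  ... | inj₁ p = ∈-++⁺ˡ p
  ... | inj₂ (here refl) = contradiction refl (All.lookup x∉ y∈)
  ... | inj₂ (there p) = ∈-++⁺ʳ as p

Unique-map⁺-local : ∀ {A B : Set} {P : A → Set} (f : A → B) →
                    (∀ {x y} → P x → P y → f x ≡ f y → x ≡ y) →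
                    ∀ {xs} → All P xs → Unique xs → Unique (map f xs)
Unique-map⁺-local f inj [] [] = []
Unique-map⁺-local f inj (px ∷ pxs) (x∉ ∷ u) =
  All.map⁺ (All.zipWith (λ (py , x≢y) e → x≢y (inj px py e)) (pxs , x∉)) ∷ Unique-map⁺-local f inj pxs u

module _ {A : Set} {xs : List A} (unique-xs : Unique xs) (complete : ∀ x → x ∈ xs)
         {P Q : A → Set} (P? : Decidable P) (Q? : Decidable Q) (f : A → A)
         (maps : ∀ {x} → P x → Q (f x))
         (inj : ∀ {x y} → P x → P y → f x ≡ f y → x ≡ y) where

  private
    unique : Unique (map f (filter P? xs))
    unique = Unique-map⁺-local f inj (All.all-filter P? xs) (Unique.filter⁺ P? unique-xs)

    image : ∀ {y} → y ∈ map f (filter P? xs) → y ∈ filter Q? xs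
    image y∈ with ∈-map⁻ f y∈
    ... | x , x∈ , refl = ∈-filter⁺ Q? (complete _) (maps (proj₂ (∈-filter⁻ P? {xs = xs} x∈)))

  injection⇒filter-≤ : length (filter P? xs) ≤ length (filter Q? xs)
  injection⇒filter-≤ = subst (_≤ _) (length-map f (filter P? xs)) (Unique-⊆⇒length-≤ unique image)

  injection⇒filter-< : ∀ {y} → Q y → (∀ {x} → P x → f x ≢ y) →
                       length (filter P? xs) < length (filter Q? xs)
  injection⇒filter-< {y} Qy missed =
    subst (_≤ length (filter Q? xs)) (cong suc (length-map f (filter P? xs)))
      (Unique-⊆⇒length-≤
        (All.map⁺ (All.map (λ Px → missed Px ∘ sym) (All.all-filter P? xs)) ∷ unique)
        λ { (here refl) → ∈-filter⁺ Q? (complete _) Qy ; (there y∈) → image y∈ })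

-- Finiteness lets the double negation pass through the quantifier, one index at a time.
-- Reachability and evenness are treated as decidable in this way inside negative goals.
¬¬-decidable : ∀ {n} {P : Fin n → Set} → ¬ ¬ Decidable P
¬¬-decidable {zero} k = k λ ()
¬¬-decidable {suc n} k = ¬¬-excluded-middle λ d₀ → ¬¬-decidable λ d →
  k λ { Fin.zero → d₀ ; (Fin.suc i) → d i }

sum-zero : ∀ {A : Set} (f : A → ℕ) as → (∀ {a} → a ∈ as → f a ≡ 0) → sum (map f as) ≡ 0
sum-zero f [] z = refl
sum-zero f (a ∷ as) z = cong₂ _+_ (z (here refl)) (sum-zero f as (z ∘ there))

sum-single : ∀ {A : Set} {f : A → ℕ} {b as} → Unique as → b ∈ as → (∀ {a} → a ≢ b → f a ≡ 0) →
             sum (map f as) ≡ f b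
sum-single {f = f} {b} {_ ∷ as} (b∉ ∷ u) (here refl) z =
  trans (cong (f b +_) (sum-zero f as λ a∈ → z λ { refl → All.lookup b∉ a∈ refl })) (+-identityʳ (f b))
sum-single {f = f} {as = _ ∷ as} (a∉ ∷ u) (there b∈) z = trans (cong (_+ sum (map f as)) (z (All.lookup a∉ b∈))) (sum-single u b∈ z)

module Matchings (G : Instance) where
  open Inst G

  -- Sizes of assignments and reassignment of one applicant

  _≟ᵖ_ : (p q : Post) → Dec (p ≡ q)
  _≟ᵖ_ = Sum.≡-dec Fin._≟_ Fin._≟_

  _≟ᵛ_ : (v w : Vertex) → Dec (v ≡ w)
  _≟ᵛ_ = Sum.≡-dec Fin._≟_ _≟ᵖ_

  _≟ᵐ_ : (x y : Maybe Post) → Dec (x ≡ y)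
  _≟ᵐ_ = Maybe.≡-dec _≟ᵖ_

  owner? : (N : Assignment) (p : Post) → Dec (∃[ a ] N a ≡ just p)
  owner? N p = any? λ a → N a ≟ᵐ just p

  defined? : (N : Assignment) → Decidable (λ (a : Applicant) → N a ≢ nothing)
  defined? N a = ¬? (N a ≟ᵐ nothing)

  size-filter : (N : Assignment) → size N ≡ length (filter (defined? N) (allFin nA))
  size-filter N = go (allFin nA)
    where
    go : ∀ as → sum (map (λ a → isMatched (N a)) as) ≡ length (filter (defined? N) as)
    go [] = refl
    go (a ∷ as) with N a
    ... | just _  = cong suc (go as)
    ... | nothing = go as

  module _ {N N₀ : Assignment} (f : Applicant → Applicant)
           (maps : ∀ {a} → N a ≢ nothing → N₀ (f a) ≢ nothing)
           (inj : ∀ {a b} → N a ≢ nothing → N b ≢ nothing → f a ≡ f b → a ≡ b) where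

    size-mono-≤ : size N ≤ size N₀
    size-mono-≤ = subst₂ _≤_ (sym (size-filter N)) (sym (size-filter N₀))
      (injection⇒filter-≤ (Unique.allFin⁺ nA) ∈-allFin (defined? N) (defined? N₀) f maps inj)

    size-mono-< : ∀ {b} → N₀ b ≢ nothing → (∀ {a} → N a ≢ nothing → f a ≢ b) → size N < size N₀
    size-mono-< d missed = subst₂ _<_ (sym (size-filter N)) (sym (size-filter N₀))
      (injection⇒filter-< (Unique.allFin⁺ nA) ∈-allFin (defined? N) (defined? N₀) f maps inj d missed)

  _[_≔_] : Assignment → Applicant → Post → Assignment
  N [ a ≔ p ] = updateAt N a (const (just p))

  assigned : ∀ (N : Assignment) a p → (N [ a ≔ p ]) a ≡ just p
  assigned N a p = updateAt-updates a N

  unassigned : ∀ (N : Assignment) {a b} p → b ≢ a → (N [ a ≔ p ]) b ≡ N b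
  unassigned N {a} {b} p b≢a = updateAt-minimal b a N b≢a

  assign-cases : ∀ (N : Assignment) {a b p q} → (N [ a ≔ p ]) b ≡ just q → (b ≡ a × q ≡ p) ⊎ (b ≢ a × N b ≡ just q)
  assign-cases N {a} {b} {p} e with b Fin.≟ a
  ... | yes refl = inj₁ (refl , Maybe.just-injective (trans (sym e) (assigned N a p)))
  ... | no b≢a   = inj₂ (b≢a , trans (sym (unassigned N p b≢a)) e)

  assign-defined : ∀ (N : Assignment) {a p b} → N b ≢ nothing → (N [ a ≔ p ]) b ≢ nothing
  assign-defined N {a} {p} {b} d with b Fin.≟ a
  ... | yes refl = λ e → case trans (sym (assigned N a p)) e of λ ()
  ... | no b≢a   = d ∘ trans (sym (unassigned N p b≢a))

  -- Here `a` may already be matched; its old partner is then simply released. `augment` relies on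
  -- this.
  assign-matching : ∀ {H N a p} → IsMatchingIn H N → H a p → Unmatched N (inj₂ p) →
                    IsMatchingIn H (N [ a ≔ p ])
  assign-matching {H} {N} {a} {p} (inH , inj) h free = inH′ , inj′
    where
    inH′ : ∀ b q → (N [ a ≔ p ]) b ≡ just q → H b q
    inH′ b q e with assign-cases N e
    ... | inj₁ (refl , refl) = h
    ... | inj₂ (_ , e′) = inH b q e′
    inj′ : ∀ b c q → (N [ a ≔ p ]) b ≡ just q → (N [ a ≔ p ]) c ≡ just q → b ≡ c
    inj′ b c q e₁ e₂ with assign-cases N e₁ | assign-cases N e₂
    ... | inj₁ (refl , _) | inj₁ (refl , _) = refl
    ... | inj₁ (refl , refl) | inj₂ (_ , e) = contradiction e (free c)
    ... | inj₂ (_ , e) | inj₁ (refl , refl) = contradiction e (free b)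
    ... | inj₂ (_ , e) | inj₂ (_ , e′) = inj b c q e e′

  -- Augmentation and König covers

  -- Vertices may repeat, and the first edge of a pair may itself lie in `N`; this looseness makes
  -- walks easy to extend and reroute. The index counts pairs of edges and is the measure for
  -- `augment`. Simple paths are recovered by `even-path` and `odd-path`.
  data EvenWalk (H : EdgeSet) (N : Assignment) : ℕ → Vertex → Set where
    start : ∀ {v} → Unmatched N v → EvenWalk H N 0 v
    next  : ∀ {ℓ u v w} → EvenWalk H N ℓ u → Adj H u v → InM N v w → EvenWalk H N (suc ℓ) w

  EvenReach OddReach : EdgeSet → Assignment → Vertex → Set
  EvenReach H N v = ∃[ ℓ ] EvenWalk H N ℓ v
  OddReach  H N v = ∃[ u ] (EvenReach H N u × Adj H u v)

  module _ {H : EdgeSet} where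

    -- Only the matching edge at `a` changes, so a walk that avoids `a` survives. Otherwise its part
    -- up to `a`, still a walk for the original `N`, is returned.
    reroute : ∀ {N a p ℓ b} → EvenWalk H N ℓ (inj₁ b) →
              EvenWalk H (N [ a ≔ p ]) ℓ (inj₁ b) ⊎ ∃[ k ] (k ≤ ℓ × EvenWalk H N k (inj₁ a))
    reroute {N} {a} {p} {b = b} w with b Fin.≟ a
    reroute w | yes refl = inj₂ (_ , ≤-refl , w)
    reroute {N} {a} {p} (start e) | no b≢a = inj₁ (start (trans (unassigned N p b≢a) e))
    reroute {N} {a} {p} (next {u = inj₁ _} {inj₂ _} w h e) | no b≢a with reroute {a = a} {p} w
    ... | inj₁ w′ = inj₁ (next {u = inj₁ _} {inj₂ _} w′ h (trans (unassigned N p b≢a) e))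
    ... | inj₂ (k , k≤ , w′) = inj₂ (k , m≤n⇒m≤1+n k≤ , w′)

    -- That no covered vertex is lost is what `no-larger` needs. Covering `p` closes the induction
    -- in `augment`: the inner call has to cover again the post that the first flip released.
    Augmentation : Assignment → Post → Set
    Augmentation N p = ∃[ N⁺ ] (IsMatchingIn H N⁺ × size N < size N⁺ ×
      (∀ v → Unmatched N⁺ v → Unmatched N v) × ¬ Unmatched N⁺ (inj₂ p))

    -- The last edge of the augmenting walk is flipped first, which frees the
    -- previous partner q of a, reached by a shorter walk.  The walk need not
    -- be a simple path: if it visits a before, it is cut off there.
    augment : ∀ {N ℓ a p} → IsMatchingIn H N → EvenWalk H N ℓ (inj₁ a) → H a p →
              Unmatched N (inj₂ p) → Augmentation N p
    augment {ℓ = ℓ} m w h free = go ℓ ≤-refl m w h free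
      where
      go : ∀ bound {N ℓ a p} → ℓ ≤ bound → IsMatchingIn H N → EvenWalk H N ℓ (inj₁ a) → H a p →
           Unmatched N (inj₂ p) → Augmentation N p
      go _ {N} {a = a} {p} _ m (start e) h free =
        N [ a ≔ p ] , assign-matching m h free ,
        size-mono-< id (assign-defined N) (λ _ _ → id) {a} (λ e′ → case trans (sym e′) (assigned N a p) of λ ())
          (λ { d refl → d e }) ,
        covers , λ u → u a (assigned N a p)
        where
        covers : ∀ v → Unmatched (N [ a ≔ p ]) v → Unmatched N v
        covers (inj₁ b) u = decidable-stable (N b ≟ᵐ nothing) λ d → assign-defined N d u
        covers (inj₂ q) u b e′ = u b (trans (unassigned N p λ { refl → case trans (sym e) e′ of λ () }) e′)
      go (suc bound) {N} {a = a} {p} (s≤s ℓ≤) m (next {u = inj₁ _} {inj₂ q} w h′ e) h free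
        with reroute {a = a} {p} w
      ... | inj₂ (_ , k≤ , w′) = go bound (≤-trans k≤ ℓ≤) m w′ h free
      ... | inj₁ w′ with go bound ℓ≤ (assign-matching m h free) w′ h′ free′
        where
        free′ : Unmatched (N [ a ≔ p ]) (inj₂ q)
        free′ b e′ with assign-cases N e′
        ... | inj₁ (refl , refl) = free a e
        ... | inj₂ (b≢a , e″) = b≢a (proj₂ m b a q e″ e)
      ... | N⁺ , m⁺ , lt , cov , covq =
        N⁺ , m⁺ , ≤-<-trans (size-mono-≤ id (assign-defined N) (λ _ _ → id)) lt , covers ,
        λ u → cov (inj₂ p) u a (assigned N a p)
        where
        covers : ∀ v → Unmatched N⁺ v → Unmatched N v
        covers (inj₁ b) u = decidable-stable (N b ≟ᵐ nothing) λ d → assign-defined N d (cov (inj₁ b) u)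
        covers (inj₂ x) u b e′ = cov (inj₂ x) u b
          (trans (unassigned N p λ { refl → covq (subst (λ y → Unmatched N⁺ (inj₂ y))
            (Maybe.just-injective (trans (sym e′) e)) u) }) e′)

    NoAugmentation : Assignment → Set
    NoAugmentation N = ∀ p → ¬ Augmentation N p

    max⇒NoAugmentation : ∀ {N} → MaxMatching H N → NoAugmentation N
    max⇒NoAugmentation (_ , max) p (N⁺ , m⁺ , lt , _) = <⇒≱ lt (max N⁺ m⁺)

    odd-post-matched : ∀ {N a} p → IsMatchingIn H N → NoAugmentation N → EvenReach H N (inj₁ a) →
                       H a p → ∃[ b ] N b ≡ just p
    odd-post-matched {N} p m noAug (_ , w) h with owner? N p
    ... | yes o = o
    ... | no ¬o = ⊥-elim (noAug p (augment m w h (λ b e → ¬o (b , e))))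

    -- The walk from an unmatched post is traversed backwards, starting from
    -- the unmatched end of the walk to a.
    no-augmenting-from-post : ∀ {N a p} → IsMatchingIn H N → NoAugmentation N → EvenReach H N (inj₂ p) →
                              EvenReach H N (inj₁ a) → ¬ H a p
    no-augmenting-from-post m noAug (_ , start free) ra h =
      let b , e = odd-post-matched _ m noAug ra h in free b e
    no-augmenting-from-post m noAug (_ , next {u = inj₂ _} {inj₁ b} w h′ e) (_ , wa) h =
      no-augmenting-from-post m noAug (_ , w) (_ , next {u = inj₁ _} {inj₂ _} wa h e) h′

    -- The applicants outside R and the neighbours of R form a König vertex
    -- cover, all of whose vertices are matched by N.
    record Barrier (N : Assignment) (R : Applicant → Set) : Set where
      field
        closed : ∀ {a p} → R a → H a p → ∃[ b ] (R b × N b ≡ just p)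
        full   : ∀ {a} → ¬ R a → N a ≢ nothing
    open Barrier

    module _ {N₀ N : Assignment} {R : Applicant → Set} (R? : Decidable R)
             (B : Barrier N₀ R) (m : IsMatchingIn H N) where

      private
        -- Weak duality as an injection: an applicant of `R` goes to the owner in `N₀` of its post,
        -- any other applicant to itself. The two kinds of image are kept apart by `R`.
        Partner : Applicant → Applicant → Set
        Partner a b = (R a × R b × N₀ b ≡ N a) ⊎ (¬ R a × b ≡ a)

        partner : ∀ a → ∃[ b ] (N a ≢ nothing → Partner a b)
        partner a with N a in e | R? a
        ... | nothing | _ = a , λ d → contradiction refl d
        ... | just p | yes r = let b , rb , e′ = closed B r (proj₁ m a p e) in b , λ _ → inj₁ (r , rb , e′)
        ... | just p | no ¬r = a , λ _ → inj₂ (¬r , refl)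

        f : Applicant → Applicant
        f = proj₁ ∘ partner

        maps : ∀ {a} → N a ≢ nothing → N₀ (f a) ≢ nothing
        maps {a} d with partner a
        ... | b , P with P d
        ... | inj₁ (_ , _ , e) = d ∘ trans (sym e)
        ... | inj₂ (¬r , refl) = full B ¬r

        injective : ∀ {a b} → N a ≢ nothing → N b ≢ nothing → f a ≡ f b → a ≡ b
        injective {a} {b} da db fe with partner a | partner b
        ... | _ , P | _ , Q with P da | Q db | fe
        ... | inj₁ (_ , r , _) | inj₂ (¬r , refl) | refl = contradiction r ¬r
        ... | inj₂ (¬r , refl) | inj₁ (_ , r , _) | refl = contradiction r ¬r
        ... | inj₂ (_ , refl) | inj₂ (_ , refl) | refl = refl
        ... | inj₁ (_ , _ , e₁) | inj₁ (_ , _ , e₂) | refl with N a in ea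
        ... | nothing = contradiction refl da
        ... | just p = proj₂ m a b p ea (trans (sym e₂) e₁)

      barrier-bound : size N ≤ size N₀
      barrier-bound = size-mono-≤ f maps injective

      -- Complementary slackness: when the sizes agree, the injection `f` hits every applicant
      -- matched by `N₀`. An applicant outside `R` can be hit only by itself, and the owner in `N₀`
      -- of a neighbour of `R` only by an applicant of `R` that `N` matches to that same post.
      barrier-transfer : size N₀ ≤ size N → Barrier N R
      barrier-transfer le = record { closed = closed′ ; full = full′ }
        where
        hit-all : ∀ {b} → N₀ b ≢ nothing → ¬ (∀ {a} → N a ≢ nothing → f a ≢ b)
        hit-all d missed = <⇒≱ (size-mono-< f maps injective d missed) le

        closed′ : ∀ {a p} → R a → H a p → ∃[ b ] (R b × N b ≡ just p)
        closed′ {a} {p} r h with any? (λ c → R? c ×-dec (N c ≟ᵐ just p))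
        ... | yes found = found
        ... | no none with closed B r h
        ... | b , rb , e = ⊥-elim (hit-all (λ e′ → case trans (sym e) e′ of λ ()) missed)
          where
          missed : ∀ {c} → N c ≢ nothing → f c ≢ b
          missed {c} d fe with partner c
          ... | x , P with P d | fe
          ... | inj₁ (rc , _ , e′) | refl = none (c , rc , trans (sym e′) e)
          ... | inj₂ (¬r , refl) | refl = ¬r rb

        full′ : ∀ {a} → ¬ R a → N a ≢ nothing
        full′ {a} ¬r e = hit-all (full B ¬r) missed
          where
          missed : ∀ {c} → N c ≢ nothing → f c ≢ a
          missed {c} d fe with partner c
          ... | x , P with P d | fe
          ... | inj₁ (_ , rx , _) | refl = ¬r rx
          ... | inj₂ (_ , refl) | refl = d e

    even-barrier : ∀ {N} → IsMatchingIn H N → NoAugmentation N →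
                   Barrier N (λ a → EvenReach H N (inj₁ a))
    even-barrier m noAug = record
      { closed = λ {a} {p} r h → let b , e = odd-post-matched p m noAug r h
                                 in b , (_ , next {u = inj₁ a} {inj₂ p} (proj₂ r) h e) , e
      ; full = λ ¬r e → ¬r (0 , start e) }

    -- Berge's theorem, with the cover of `even-barrier` as the certificate of optimality.
    NoAugmentation⇒max : ∀ {N} → IsMatchingIn H N → NoAugmentation N → MaxMatching H N
    NoAugmentation⇒max {N} m noAug = m , λ N′ m′ → decidable-stable (size N′ ≤? size N) λ ¬le →
      ¬¬-decidable λ R? → ¬le (barrier-bound R? (even-barrier m noAug) m′)

    -- The opposite extreme cover, grown from the unmatched posts. An unmatched neighbour of `a`, or
    -- a neighbour whose partner is odd, would make `a` odd; an unmatched odd applicant would end an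
    -- augmenting walk.
    odd-barrier : ∀ {N} → IsMatchingIn H N → NoAugmentation N →
                  Barrier N (λ a → ¬ OddReach H N (inj₁ a))
    odd-barrier {N} m noAug = record { closed = closed′ ; full = full′ }
      where
      closed′ : ∀ {a p} → ¬ OddReach H N (inj₁ a) → H a p → ∃[ b ] (¬ OddReach H N (inj₁ b) × N b ≡ just p)
      closed′ {a} {p} ¬o h with owner? N p
      ... | no none = contradiction (inj₂ p , (0 , start λ b e → none (b , e)) , h) ¬o
      ... | yes (b , e) =
        b , (λ { (inj₂ q , (_ , w) , h′) → ¬o (inj₂ p , (_ , next {u = inj₂ q} {inj₁ b} w h′ e) , h) }) , e
      full′ : ∀ {a} → ¬ ¬ OddReach H N (inj₁ a) → N a ≢ nothing
      full′ ¬¬o e = ¬¬o λ { (inj₂ q , r , h) → no-augmenting-from-post m noAug r (0 , start e) h }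

    -- Going back along the walk, each post is again adjacent to `R`, because `closed` puts its
    -- partner in `R`. The unmatched start would then have to be matched.
    barrier-even-post : ∀ {N R ℓ a p} → IsMatchingIn H N → Barrier N R → EvenWalk H N ℓ (inj₂ p) →
                        R a → ¬ H a p
    barrier-even-post m B (start free) r h = let b , _ , e = closed B r h in free b e
    barrier-even-post {R = R} m B (next {u = inj₂ p} {inj₁ b} w h′ e) r h =
      let c , rc , e′ = closed B r h
      in barrier-even-post m B w (subst R (proj₂ m c b _ e′ e) rc) h′

    barrier-even-applicant : ∀ {N R ℓ a} → IsMatchingIn H N → Barrier N R → EvenWalk H N ℓ (inj₁ a) → ¬ ¬ R a
    barrier-even-applicant m B (start e) ¬r = full B ¬r e
    barrier-even-applicant {R = R} m B (next {u = inj₁ _} {inj₂ _} w h e) ¬r =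
      barrier-even-applicant m B w λ r → let b , rb , e′ = closed B r h
        in ¬r (subst R (proj₂ m _ _ _ e′ e) rb)

    -- This replaces the independence of the decomposition from the maximum matching: facts
    -- witnessed by different matchings are compared through one shared cover.
    transfer : ∀ {N₀ N R} → MaxMatching H N₀ → MaxMatching H N → Barrier N₀ R → ¬ ¬ Barrier N R
    transfer (m₀ , max₀) (m , max) B k = ¬¬-decidable λ R? → k (barrier-transfer R? B m (max _ m₀))

  -- Even, odd and unreachable vertices

  side : Vertex → Bool
  side (inj₁ _) = true
  side (inj₂ _) = false

  Adj-side : ∀ {H u v} → Adj H u v → side v ≡ not (side u)
  Adj-side {u = inj₁ _} {inj₂ _} _ = refl
  Adj-side {u = inj₂ _} {inj₁ _} _ = refl

  InM-sym : ∀ {N u v} → InM N u v → InM N v u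
  InM-sym {u = inj₁ _} {inj₂ _} e = e
  InM-sym {u = inj₂ _} {inj₁ _} e = e

  InM⇒Adj : ∀ {H N u v} → IsMatchingIn H N → InM N u v → Adj H u v
  InM⇒Adj {u = inj₁ a} {inj₂ p} (inH , _) e = inH a p e
  InM⇒Adj {u = inj₂ p} {inj₁ a} (inH , _) e = inH a p e

  InM-functional : ∀ {H N u v w} → IsMatchingIn H N → InM N u v → InM N u w → v ≡ w
  InM-functional {u = inj₁ _} {inj₂ _} {inj₂ _} _ e e′ = cong inj₂ (Maybe.just-injective (trans (sym e) e′))
  InM-functional {u = inj₂ p} {inj₁ a} {inj₁ b} (_ , inj) e e′ = cong inj₁ (inj a b p e e′)

  Unmatched⇒¬InM : ∀ {N u v} → Unmatched N u → ¬ InM N u v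
  Unmatched⇒¬InM {u = inj₁ _} {inj₂ _} e e′ = case trans (sym e) e′ of λ ()
  Unmatched⇒¬InM {u = inj₂ _} {inj₁ a} u e = u a e

  endpoint-++ : ∀ {X : Set} (v : X) ws us → endpoint v (ws ++ us) ≡ endpoint (endpoint v ws) us
  endpoint-++ v [] us = refl
  endpoint-++ v (w ∷ ws) us = endpoint-++ w ws us

  endpoint-∈ : ∀ {X : Set} (v : X) ws → endpoint v ws ∈ v ∷ ws
  endpoint-∈ v [] = here refl
  endpoint-∈ v (w ∷ ws) = there (endpoint-∈ w ws)

  after : Bool → List Vertex → Bool
  after b []       = b
  after b (_ ∷ ws) = after (not b) ws

  module _ {H : EdgeSet} {N : Assignment} where

    side-two : ∀ {u v w} → Adj H u v → Adj H v w → side w ≡ side u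
    side-two {u} h h′ = trans (Adj-side h′) (trans (cong not (Adj-side h)) (not-involutive (side u)))

    ¬closing : ∀ {u v} {A : Set} → Adj H u v → side v ≡ side u → A
    ¬closing h e = contradiction (Adj-side h) (not-¬ e)

    parity-even : ∀ {b v ws} → AltSteps H N b v ws → side (endpoint v ws) ≡ side v → length ws % 2 ≡ 0
    parity-even done _ = refl
    parity-even (step h _ done) e = ¬closing h e
    parity-even (step h _ (step h′ _ s)) e = parity-even s (trans e (sym (side-two h h′)))

    parity-odd : ∀ {b v ws} → AltSteps H N b v ws → side (endpoint v ws) ≡ not (side v) → length ws % 2 ≡ 1
    parity-odd done e = contradiction e (not-¬ refl)
    parity-odd (step h _ done) _ = refl
    parity-odd (step h _ (step h′ _ s)) e = parity-odd s (trans e (cong not (sym (side-two h h′))))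

    after-even : ∀ {b v ws} → AltSteps H N b v ws → side (endpoint v ws) ≡ side v → after b ws ≡ b
    after-even done _ = refl
    after-even (step h _ done) e = ¬closing h e
    after-even {b} (step {ws = _ ∷ ws} h _ (step h′ _ s)) e =
      trans (after-even s (trans e (sym (side-two h h′)))) (not-involutive b)

    append : ∀ {b v ws us} → AltSteps H N b v ws → AltSteps H N (after b ws) (endpoint v ws) us →
             AltSteps H N b v (ws ++ us)
    append done s′ = s′
    append (step h i s) s′ = step h i (append s s′)

    truncate : ∀ {b v ws x} → AltSteps H N b v ws → Unique (v ∷ ws) → x ∈ v ∷ ws →
               ∃[ us ] (AltSteps H N b v us × Unique (v ∷ us) × endpoint v us ≡ x × (∀ {y} → y ∈ us → y ∈ ws))
    truncate s _ (here refl) = [] , done , [] ∷ [] , refl , λ ()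
    truncate (step h i s) (v∉ ∷ u) (there x∈) with truncate s u x∈
    ... | us , s′ , u′ , e , sub =
      _ , step h i s′ , All.tabulate (λ y∈ → All.lookup v∉ (sub′ y∈)) ∷ u′ , e , sub′
      where
      sub′ : ∀ {y} → y ∈ _ ∷ us → y ∈ _
      sub′ (here refl) = here refl
      sub′ (there y∈) = there (sub y∈)

    alternating⇒EvenReach : ∀ {v ws} → AltSteps H N false v ws → EvenReach H N v → length ws % 2 ≡ 0 →
                            EvenReach H N (endpoint v ws)
    alternating⇒EvenReach done r _ = r
    alternating⇒EvenReach (step h _ (step _ i s)) (_ , w) e = alternating⇒EvenReach s (_ , next w h i) e

    alternating⇒OddReach : ∀ {v ws} → AltSteps H N false v ws → EvenReach H N v → length ws % 2 ≡ 1 →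
                           OddReach H N (endpoint v ws)
    alternating⇒OddReach (step h _ done) r _ = _ , r , h
    alternating⇒OddReach (step h _ (step _ i s)) (_ , w) e = alternating⇒OddReach s (_ , next w h i) e

    module _ (m : IsMatchingIn H N) where

      -- Equal sides at both ends mean even length, so a vertex of the opposite side is never last,
      -- and the step leaving it is its matching edge.
      partner-∈ : ∀ {v ws y z} → AltSteps H N false v ws → side (endpoint v ws) ≡ side v →
                  y ∈ v ∷ ws → side y ≢ side v → InM N y z → z ∈ v ∷ ws
      partner-∈ _ _ (here refl) ne _ = contradiction refl ne
      partner-∈ (step h _ done) e _ _ _ = ¬closing h e
      partner-∈ (step _ _ (step _ i s)) _ (there (here refl)) _ i′ =
        there (there (here (InM-functional m i′ i)))
      partner-∈ (step h _ (step h′ _ s)) e (there (there y∈)) ne i =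
        let e′ = side-two h h′
        in there (there (partner-∈ s (trans e (sym e′)) y∈ (λ f → ne (trans f e′)) i))

      -- `c` is the side of the start. By bipartiteness the sides of the two ends determine the
      -- parity of the length, so a path can be cut anywhere without tracking lengths.
      SimplePath : Bool → Vertex → Set
      SimplePath c v = ∃[ v₀ ] ∃[ ws ] (Unmatched N v₀ × side v₀ ≡ c × AltSteps H N false v₀ ws ×
                                        Unique (v₀ ∷ ws) × endpoint v₀ ws ≡ v)

      cut-at : ∀ {c v x} → ((v₀ , ws , _) : SimplePath c v) → x ∈ v₀ ∷ ws → SimplePath c x
      cut-at (v₀ , ws , f , c , s , u , _) x∈ =
        let us , s′ , u′ , e , _ = truncate s u x∈ in v₀ , us , f , c , s′ , u′ , e

      extend : ∀ {v us} → ((v₀ , ws , _) : SimplePath (side v) v) → AltSteps H N false v us → Unique us →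
               (∀ {x} → x ∈ us → x ∉ v₀ ∷ ws) → SimplePath (side v) (endpoint v us)
      extend {us = us} (v₀ , ws , f , c , s , u , refl) s′ u′ disjoint =
        v₀ , ws ++ us , f , c ,
        append s (subst (λ b → AltSteps H N b (endpoint v₀ ws) us) (sym (after-even s (sym c))) s′) ,
        Unique.++⁺ u u′ (λ (x∈ , x∈′) → disjoint x∈′ x∈) ,
        endpoint-++ v₀ ws us

      -- If `w` already lies on the path, cutting there keeps the parity, as `w` is on the side of
      -- the start. Otherwise `v` is new as well, since `partner-∈` would put `w` on the path, and
      -- both vertices can be appended.
      even-path : ∀ {ℓ v} → EvenWalk H N ℓ v → SimplePath (side v) v
      even-path {v = v} (start f) = v , [] , f , refl , done , [] ∷ [] , refl
      even-path (next {u = u} {v} {w} r h i) with even-path r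
      ... | π@(v₀ , ws , f , c , s , uq , refl) with _∈?_ _≟ᵛ_ w (v₀ ∷ ws)
      ...   | yes w∈ = subst (λ b → SimplePath b w) (sym sw) (cut-at π w∈)
        where
        sw : side w ≡ side (endpoint v₀ ws)
        sw = side-two h (InM⇒Adj m i)
      ...   | no w∉ = subst (λ b → SimplePath b w) (sym sw)
        (extend π (step h (λ i′ → w∉ (subst (_∈ v₀ ∷ ws) (InM-functional m (InM-sym i′) i) (endpoint-∈ v₀ ws)))
                  (step (InM⇒Adj m i) i done))
          (((λ { refl → ¬closing {w} (InM⇒Adj m i) refl }) ∷ []) ∷ [] ∷ [])
          λ { (here refl) v∈ → w∉ (partner-∈ s (sym c) v∈ (λ e → not-¬ (trans e c) (Adj-side h)) i)
            ; (there (here refl)) → w∉ })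
        where
        sw : side w ≡ side (endpoint v₀ ws)
        sw = side-two h (InM⇒Adj m i)

      odd-path : ∀ {ℓ u w} → EvenWalk H N ℓ u → Adj H u w → SimplePath (side u) w
      odd-path {u = u} {w} r h with even-path r
      ... | π@(v₀ , ws , _) with _∈?_ _≟ᵛ_ w (v₀ ∷ ws)
      ...   | yes w∈ = cut-at π w∈
      ...   | no w∉ = go r
        where
        add : ¬ InM N u w → SimplePath (side u) w
        add ¬i = extend π (step h ¬i done) ([] ∷ []) λ { (here refl) → w∉ }
        go : ∀ {ℓ} → EvenWalk H N ℓ u → SimplePath (side u) w
        go (start f) = add (Unmatched⇒¬InM f)
        go (next {v = v} r′ h′ i) with v ≟ᵛ w
        -- The edge to `w` is the matching edge by which the walk arrived at `u`, hence not allowed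
        -- as the next step; but the walk had reached `w` just before.
        ... | yes refl = subst (λ b → SimplePath b w) (sym (side-two h′ (InM⇒Adj m i))) (odd-path r′ h′)
        ... | no v≢w = add λ i′ → v≢w (InM-functional m (InM-sym i) i′)

      EvenReach⇒path : ∀ {v} → EvenReach H N v → AltPathTo H N 0 v
      EvenReach⇒path (_ , r) with even-path r
      ... | v₀ , ws , f , c , s , u , refl = v₀ , ws , f , s , u , refl , parity-even s (sym c)

      OddReach⇒path : ∀ {v} → OddReach H N v → AltPathTo H N 1 v
      OddReach⇒path (u , (_ , r) , h) with odd-path r h
      ... | v₀ , ws , f , c , s , uq , refl =
        v₀ , ws , f , s , uq , refl , parity-odd s (trans (Adj-side h) (cong not (sym c)))

    path⇒EvenReach : ∀ {v} → AltPathTo H N 0 v → EvenReach H N v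
    path⇒EvenReach (_ , _ , f , s , _ , refl , e) = alternating⇒EvenReach s (0 , start f) e

    path⇒OddReach : ∀ {v} → AltPathTo H N 1 v → OddReach H N v
    path⇒OddReach (_ , _ , f , s , _ , refl , e) = alternating⇒OddReach s (0 , start f) e

  -- Consequences that hold for all maximum matchings at once

  module _ {H : EdgeSet} where
    open Barrier

    Unmatched⇒EvenV : ∀ {N v} → MaxMatching H N → Unmatched N v → EvenV H v
    Unmatched⇒EvenV mx f = _ , mx , EvenReach⇒path (proj₁ mx) (0 , start f)

    -- The two paths may belong to different maximum matchings. A cover built from the matching of
    -- the odd path is transferred to that of the even path, where it excludes the even path.
    EvenV⇒¬OddV : ∀ {v} → EvenV H v → ¬ OddV H v
    EvenV⇒¬OddV {inj₁ a} (N , mx , π) (N₁ , mx₁ , π₁) =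
      transfer mx₁ mx (odd-barrier (proj₁ mx₁) (max⇒NoAugmentation mx₁)) λ B →
        barrier-even-applicant (proj₁ mx) B (proj₂ (path⇒EvenReach π)) λ ¬o → ¬o (path⇒OddReach π₁)
    EvenV⇒¬OddV {inj₂ p} (N , mx , π) (N₁ , mx₁ , π₁) with path⇒OddReach π₁
    ... | inj₁ a , r , h =
      transfer mx₁ mx (even-barrier (proj₁ mx₁) (max⇒NoAugmentation mx₁)) λ B → barrier-even-post (proj₁ mx) B (proj₂ (path⇒EvenReach π)) r h

    EvenV⇒¬OU : ∀ {v} → EvenV H v → ¬ OU H v
    EvenV⇒¬OU e (inj₁ o) = EvenV⇒¬OddV e o
    EvenV⇒¬OU e (inj₂ (¬e , _)) = ¬e e

    ¬EvenV⇒¬¬OU : ∀ {v} → ¬ EvenV H v → ¬ ¬ OU H v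
    ¬EvenV⇒¬¬OU ¬e ¬ou = ¬ou (inj₂ (¬e , λ o → ¬ou (inj₁ o)))

    -- If `a` is odd for `N₁`, the transferred `odd-barrier` makes it odd for `N`, so its partner
    -- `p` is even. If `p` is odd for `N₁`, the transferred `even-barrier` makes its partner `a`
    -- even. Either way the other end is not in `OU`.
    max⇒¬Del : ∀ {N a p} → MaxMatching H N → N a ≡ just p → ¬ Del H a p
    max⇒¬Del {N} {a} {p} mx e (inj₁ ((N₁ , mx₁ , π₁) , ou)) with path⇒OddReach π₁
    ... | inj₂ p₀ , (_ , r) , h = transfer mx mx₁ (odd-barrier (proj₁ mx) (max⇒NoAugmentation mx)) λ B →
      barrier-even-post (proj₁ mx₁) B r
        (λ { (inj₂ q , (_ , r′) , h′) →
             EvenV⇒¬OU (N , mx , EvenReach⇒path (proj₁ mx) (_ , next {u = inj₂ q} {inj₁ a} r′ h′ e)) ou }) h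
    max⇒¬Del {N} {a} {p} mx e (inj₂ (ou , (N₁ , mx₁ , π₁))) with path⇒OddReach π₁
    ... | inj₁ a′ , r , h = transfer mx₁ mx (even-barrier (proj₁ mx₁) (max⇒NoAugmentation mx₁)) λ B →
      let b , rb , e′ = closed B r h
      in EvenV⇒¬OU (N₁ , mx₁ , EvenReach⇒path (proj₁ mx₁)
           (subst (λ c → EvenReach H N₁ (inj₁ c)) (proj₂ (proj₁ mx) b a p e′ e) rb)) ou

    -- The even applicants form a barrier for N₁: a neighbour of an even
    -- applicant is odd, hence covered by N₁, and its partner is even because
    -- the edge between them is not deleted.
    covering-max : ∀ {N N₁} → IsMatchingIn H N₁ → (∀ {a p} → N₁ a ≡ just p → ¬ Del H a p) →
                   (∀ v → Unmatched N₁ v → ¬ OU H v) → IsMatchingIn H N → size N ≤ size N₁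
    covering-max {N} {N₁} m₁ ¬del cov m = decidable-stable (size N ≤? size N₁) λ ¬le →
      ¬¬-decidable λ R? → ¬le (barrier-bound R? (barrier R?) m)
      where
      barrier : Decidable (λ a → EvenV H (inj₁ a)) → Barrier N₁ (λ a → EvenV H (inj₁ a))
      barrier R? = record { closed = closed′ ; full = λ ¬e f → ¬EvenV⇒¬¬OU ¬e (cov _ f) }
        where
        closed′ : ∀ {a p} → EvenV H (inj₁ a) → H a p → ∃[ b ] (EvenV H (inj₁ b) × N₁ b ≡ just p)
        closed′ {a} {p} (N₀ , mx₀ , π) h with owner? N₁ p
        ... | no none = contradiction (inj₁ odd) (cov (inj₂ p) λ b e → none (b , e))
          where
          odd : OddV H (inj₂ p)
          odd = N₀ , mx₀ , OddReach⇒path (proj₁ mx₀) (inj₁ a , path⇒EvenReach π , h)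
        ... | yes (b , e) with R? b
        ...   | yes rb = b , rb , e
        ...   | no ¬e = ⊥-elim (¬EvenV⇒¬¬OU ¬e λ ou → ¬del e (inj₂ (ou ,
          (N₀ , mx₀ , OddReach⇒path (proj₁ mx₀) (inj₁ a , path⇒EvenReach π , h)))))

  -- Rank-maximal matchings in the reduced graphs

  count-cong : ∀ {f g : Applicant → ℕ} → (∀ a → f a ≡ g a) → count f ≡ count g
  count-cong f≗g = cong sum (map-cong f≗g (allFin nA))

  count-+ : ∀ (f g : Applicant → ℕ) → count (λ a → f a + g a) ≡ count f + count g
  count-+ f g = go (allFin nA)
    where
    go : ∀ as → sum (map (λ a → f a + g a) as) ≡ sum (map f as) + sum (map g as)
    go [] = refl
    go (a ∷ as) = trans (cong ((f a + g a) +_) (go as)) (+-interchange (f a) (g a) _ _)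

  -- 0 stands for a missing edge; actual ranks are positive.
  ρ : Applicant → Post → ℕ
  ρ a p = fromMaybe 0 (rank a p)

  rank⇒ρ : ∀ {a} p {i} → rank a p ≡ just i → ρ a p ≡ i
  rank⇒ρ _ = cong (fromMaybe 0)

  rank-positive : ∀ {a} p {i} → rank a p ≡ just i → 1 ≤ i × i ≤ suc r
  rank-positive {a} (inj₁ p) {i} e = let l , u = rk-range a p i e in l , m≤n⇒m≤1+n u
  rank-positive {a} (inj₂ b) e with a Fin.≟ b
  rank-positive {a} (inj₂ b) refl | yes _ = s≤s z≤n , ≤-refl
  rank-positive {a} (inj₂ b) () | no _

  keep : ℕ → Applicant → Maybe Post → Maybe Post
  keep k a (just p) = if ρ a p ≤ᵇ k then just p else nothing
  keep k a nothing  = nothing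

  _↾_ : Assignment → ℕ → Assignment
  (N ↾ k) a = keep k a (N a)

  ↾-just⁺ : ∀ {N : Assignment} {k a p} → N a ≡ just p → ρ a p ≤ k → (N ↾ k) a ≡ just p
  ↾-just⁺ {k = k} {a} {p} e le rewrite e | dec-true (ρ a p ≤? k) le = refl

  ↾-just⁻ : ∀ {N : Assignment} {k a p} → (N ↾ k) a ≡ just p → N a ≡ just p × ρ a p ≤ k
  ↾-just⁻ {N} {k} {a} e with N a
  ... | just q with ρ a q ≤? k
  ↾-just⁻ {N} {k} {a} e | just q | yes le rewrite dec-true (ρ a q ≤? k) le with refl ← e = refl , le
  ↾-just⁻ {N} {k} {a} e | just q | no nle rewrite dec-false (ρ a q ≤? k) nle with () ← e

  Unmatched-⊆ : ∀ {N N′ : Assignment} {v} → (∀ {a p} → N a ≡ just p → N′ a ≡ just p) →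
                Unmatched N′ v → Unmatched N v
  Unmatched-⊆ {N} {v = inj₁ a} sub u with N a in e
  ... | nothing = refl
  ... | just p  = case trans (sym u) (sub e) of λ ()
  Unmatched-⊆ {v = inj₂ p} sub u a e = u a (sub e)

  ↾-⊆ : ∀ {N : Assignment} {k a p} → (N ↾ k) a ≡ just p → N a ≡ just p
  ↾-⊆ {N} = proj₁ ∘ ↾-just⁻ {N}

  ↾-mono : ∀ {N : Assignment} {k l a p} → k ≤ l → (N ↾ k) a ≡ just p → (N ↾ l) a ≡ just p
  ↾-mono {N} k≤l e = let e′ , le = ↾-just⁻ {N} e in ↾-just⁺ {N} e′ (≤-trans le k≤l)

  ↾-matching : ∀ {H H′ N} k → IsMatchingIn H N → (∀ {a p} → N a ≡ just p → ρ a p ≤ k → H′ a p) →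
               IsMatchingIn H′ (N ↾ k)
  ↾-matching {N = N} k (_ , inj) inH′ =
    (λ a p e → let e′ , le = ↾-just⁻ {N} e in inH′ e′ le) ,
    (λ a b p e e′ → inj a b p (↾-⊆ {N} e) (↾-⊆ {N} e′))

  rank-layer : ∀ k j (p : Post) →
    isMatched (if j ≤ᵇ suc k then just p else nothing) ≡
    isMatched (if j ≤ᵇ k then just p else nothing) + (if suc k ≡ᵇ j then 1 else 0)
  rank-layer k j p with <-cmp j (suc k)
  ... | tri< lt ne _ rewrite dec-true (j ≤? suc k) (<⇒≤ lt) | dec-true (j ≤? k) (s≤s⁻¹ lt)
                           | dec-false (suc k ≟ j) (ne ∘ sym) = refl
  ... | tri≈ _ refl _ rewrite dec-true (suc k ≤? suc k) ≤-refl | dec-false (suc k ≤? k) 1+n≰n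
                            | dec-true (k ≟ k) refl = refl
  ... | tri> nlt ne gt rewrite dec-false (j ≤? suc k) (<⇒≱ gt) | dec-false (j ≤? k) (λ le → nlt (s≤s le))
                             | dec-false (suc k ≟ j) (ne ∘ sym) = refl

  -- Signatures are compared through the sizes of the truncations, as maximality speaks about sizes.
  size-↾-suc : ∀ N k → size (N ↾ suc k) ≡ size (N ↾ k) + sig N (suc k)
  size-↾-suc N k = trans (count-cong pointwise) (count-+ (isMatched ∘ (N ↾ k)) (λ a → hit (suc k) a (N a)))
    where
    pointwise : ∀ a → isMatched ((N ↾ suc k) a) ≡ isMatched ((N ↾ k) a) + hit (suc k) a (N a)
    pointwise a with N a
    ... | nothing = refl
    ... | just p with rank a p
    ...   | nothing = refl
    ...   | just j  = rank-layer k j p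

  -- The life of an edge through the reduced graphs

  Gr-rank : ∀ n {a p} → Gr n a p → ∃[ j ] (rank a p ≡ just (suc j) × j ≤ n)
  Gr-rank zero    e              = 0 , e , z≤n
  Gr-rank (suc n) (inj₁ (g , _)) = let j , e , le = Gr-rank n g in j , e , m≤n⇒m≤1+n le
  Gr-rank (suc n) (inj₂ (e , _)) = suc n , e , ≤-refl

  rank-injective : ∀ {a} p {i j} → rank a p ≡ just (suc i) → rank a p ≡ just (suc j) → i ≡ j
  rank-injective _ e e′ with refl ← trans (sym e) e′ = refl

  -- An edge of rank `suc j` can enter at level `j` only and never returns once deleted, so its
  -- presence at level `n` shows that it survived every level in between.
  Gr-down : ∀ n {a} p {j k} → Gr n a p → rank a p ≡ just (suc j) → j ≤ k → k < n →
            Gr k a p × ¬ Del (Gr k) a p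
  Gr-down (suc n) p {k = k} (inj₁ (g , nd)) e j≤k k<n with k ≟ n
  ... | yes refl = g , nd
  ... | no k≢n   = Gr-down n p g e j≤k (≤∧≢⇒< (s≤s⁻¹ k<n) k≢n)
  Gr-down (suc n) p (inj₂ (e′ , _)) e j≤k k<n with rank-injective p e e′
  ... | refl = contradiction k<n (≤⇒≯ j≤k)

  Alive-lookup : ∀ n {v k} → Alive n v → k ≤ n → ¬ OU (Gr k) v
  Alive-lookup zero al z≤n = al
  Alive-lookup (suc n) {k = k} (al , ¬ou) k≤ with k ≟ suc n
  ... | yes refl = ¬ou
  ... | no k≢    = Alive-lookup n al (s≤s⁻¹ (≤∧≢⇒< k≤ k≢))

  Alive-tabulate : ∀ n {v} → (∀ k → k ≤ n → ¬ OU (Gr k) v) → Alive n v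
  Alive-tabulate zero    f = f 0 z≤n
  Alive-tabulate (suc n) f = Alive-tabulate n (λ k k≤ → f k (m≤n⇒m≤1+n k≤)) , f (suc n) ≤-refl

  Gr-alive : ∀ n {a} p {j k} → Gr n a p → rank a p ≡ just (suc j) → k < j →
             ¬ OU (Gr k) (inj₁ a) × ¬ OU (Gr k) (inj₂ p)
  Gr-alive zero p g e k<j with rank-injective p e g
  Gr-alive zero p g e () | refl
  Gr-alive (suc n) p (inj₁ (g , _)) e k<j = Gr-alive n p g e k<j
  Gr-alive (suc n) p (inj₂ (e′ , ala , alp)) e k<j with rank-injective p e e′
  ... | refl = Alive-lookup n ala (s≤s⁻¹ k<j) , Alive-lookup n alp (s≤s⁻¹ k<j)

  Gr-enter : ∀ j {a p} → rank a p ≡ just (suc j) →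
             (∀ k → k < j → ¬ OU (Gr k) (inj₁ a) × ¬ OU (Gr k) (inj₂ p)) → Gr j a p
  Gr-enter zero    e al = e
  Gr-enter (suc j) e al = inj₂ (e , Alive-tabulate j (λ k k≤ → proj₁ (al k (s≤s k≤))) ,
                                    Alive-tabulate j (λ k k≤ → proj₂ (al k (s≤s k≤))))

  Gr-up : ∀ n {a p j} → j ≤ n → Gr j a p → (∀ k → j ≤ k → k < n → ¬ Del (Gr k) a p) → Gr n a p
  Gr-up zero z≤n g nd = g
  Gr-up (suc n) {j = j} j≤ g nd with j ≟ suc n
  ... | yes refl = g
  ... | no j≢ = let j≤n = s≤s⁻¹ (≤∧≢⇒< j≤ j≢)
                in inj₁ (Gr-up n j≤n g (λ k j≤k k<n → nd k j≤k (m<n⇒m<1+n k<n)) , nd n j≤n ≤-refl)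

  edge-rank : ∀ {N} → IsMatchingIn EdgesG N → ∀ {a p} → N a ≡ just p →
              ∃[ j ] (rank a p ≡ just (suc j) × j ≤ r)
  edge-rank m {a} {p} e with proj₁ m a p e
  ... | zero  , e′ = contradiction (proj₁ (rank-positive p e′)) λ ()
  ... | suc j , e′ = j , e′ , s≤s⁻¹ (proj₂ (rank-positive p e′))

  module _ {M : Assignment} (rM : RankMaximal M) where

    private
      mM : IsMatchingIn EdgesG M
      mM = proj₁ rM

    -- The shift by one is due to `Gr n` being the reduced graph with edges of rank at most `suc n`.
    LayersMax : ℕ → Set
    LayersMax n = MaxMatching (Gr n) (M ↾ suc n)

    module _ (n : ℕ) (n≤r : n ≤ r) (below : ∀ k → k < n → LayersMax k) where

      private
        N : Assignment
        N = M ↾ suc n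

      lower-unmatched⇒¬OU : ∀ {k v} → k < n → Unmatched (M ↾ suc k) v → ¬ OU (Gr k) v
      lower-unmatched⇒¬OU k<n u = EvenV⇒¬OU (Unmatched⇒EvenV (below _ k<n) u)

      -- Below the level of its rank, both ends of the edge are unmatched by the truncation of `M`,
      -- hence even there, so the edge is not discarded. From that level on it belongs to a maximum
      -- matching, so it is not deleted.
      M-layers⊆Gr : ∀ {a p} → M a ≡ just p → ρ a p ≤ suc n → Gr n a p
      M-layers⊆Gr {a} {p} e le with edge-rank mM e
      ... | j , ej , _ = Gr-up n j≤n (Gr-enter j ej alive) λ k j≤k k<n → max⇒¬Del (below k k<n)
                           (↾-just⁺ {M} e (≤-trans (≤-reflexive (rank⇒ρ p ej)) (s≤s j≤k)))
        where
        j≤n : j ≤ n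
        j≤n = s≤s⁻¹ (subst (_≤ suc n) (rank⇒ρ p ej) le)
        too-high : ∀ {k q} → k < j → (M ↾ suc k) a ≢ just q
        too-high {k} k<j e′ with ↾-just⁻ {M} e′
        ... | e″ , le′ with refl ← trans (sym e) e″ =
          <⇒≱ (s≤s k<j) (subst (_≤ suc k) (rank⇒ρ p ej) le′)
        alive : ∀ k → k < j → ¬ OU (Gr k) (inj₁ a) × ¬ OU (Gr k) (inj₂ p)
        alive k k<j = lower-unmatched⇒¬OU k<n unmatched , lower-unmatched⇒¬OU k<n λ b e′ →
            too-high k<j (subst (λ c → (M ↾ suc k) c ≡ just p) (proj₂ mM b a p (↾-⊆ {M} e′) e) e′)
          where
          k<n : k < n
          k<n = <-≤-trans k<j j≤n
          unmatched : (M ↾ suc k) a ≡ nothing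
          unmatched with (M ↾ suc k) a in e′
          ... | nothing = refl
          ... | just q  = contradiction e′ (too-high k<j)

      N-matching : IsMatchingIn (Gr n) N
      N-matching = ↾-matching (suc n) mM M-layers⊆Gr

      -- An augmented matching N⁺ still covers all odd and unreachable
      -- vertices of the lower levels, so it is maximum there and has the
      -- same signature up to rank n; its extra edge has rank n + 1.
      no-larger : ∀ {N⁺} → IsMatchingIn (Gr n) N⁺ → size N < size N⁺ →
                  ¬ (∀ v → Unmatched N⁺ v → Unmatched N v)
      no-larger {N⁺} m⁺ lt cov =
        proj₂ rM N⁺ m⁺G (suc n , s≤s z≤n , s≤s n≤r , sigs , +-cancelˡ-< (size (M ↾ n)) _ _ top)
        where
        m⁺G : IsMatchingIn EdgesG N⁺
        m⁺G = (λ a p e → let j , e′ , _ = Gr-rank n (proj₁ m⁺ a p e) in suc j , e′) , proj₂ m⁺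

        undefined-at-0 : ∀ {N′} → IsMatchingIn EdgesG N′ → ∀ {a} → (N′ ↾ 0) a ≡ nothing
        undefined-at-0 {N′} m {a} with (N′ ↾ 0) a in e
        ... | nothing = refl
        ... | just p = let e′ , le = ↾-just⁻ {N′} e
                           j , ej , _ = edge-rank m e′
                       in case subst (_≤ 0) (rank⇒ρ p ej) le of λ ()

        module _ {k : ℕ} (k<n : k < n) where
          low : Assignment
          low = N⁺ ↾ suc k

          low-matching : IsMatchingIn (Gr k) low
          low-matching = ↾-matching (suc k) m⁺ λ {a} {p} e le →
            let j , ej , _ = Gr-rank n (proj₁ m⁺ a p e)
            in proj₁ (Gr-down n p (proj₁ m⁺ a p e) ej (s≤s⁻¹ (subst (_≤ suc k) (rank⇒ρ p ej) le)) k<n)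

          low-¬Del : ∀ {a p} → low a ≡ just p → ¬ Del (Gr k) a p
          low-¬Del {a} {p} e =
            let e′ , le = ↾-just⁻ {N⁺} e
                j , ej , _ = Gr-rank n (proj₁ m⁺ a p e′)
            in proj₂ (Gr-down n p (proj₁ m⁺ a p e′) ej (s≤s⁻¹ (subst (_≤ suc k) (rank⇒ρ p ej) le)) k<n)

          -- At odd and unreachable vertices of level `k` all edges of rank above `suc k` have been
          -- discarded.
          OU⇒low : ∀ {a p} → N⁺ a ≡ just p → OU (Gr k) (inj₁ a) ⊎ OU (Gr k) (inj₂ p) → low a ≡ just p
          OU⇒low {a} {p} e ou with Gr-rank n (proj₁ m⁺ a p e)
          ... | j , ej , _ with j ≤? k
          ...   | yes j≤k = ↾-just⁺ {N⁺} e (≤-trans (≤-reflexive (rank⇒ρ p ej)) (s≤s j≤k))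
          ...   | no j≰k = let ¬oua , ¬oup = Gr-alive n p (proj₁ m⁺ a p e) ej (≰⇒> j≰k)
                           in contradiction ou [ ¬oua , ¬oup ]′

          low-unmatched : ∀ v → Unmatched low v → OU (Gr k) v → Unmatched N⁺ v
          low-unmatched (inj₁ a) u ou with N⁺ a in e
          ... | nothing = refl
          ... | just p  = contradiction (trans (sym (trans (cong (keep (suc k) a) e) u)) (OU⇒low e (inj₁ ou))) λ ()
          low-unmatched (inj₂ p) u ou a e = u a (OU⇒low e (inj₂ ou))

          low-cover : ∀ v → Unmatched low v → ¬ OU (Gr k) v
          low-cover v u ou = lower-unmatched⇒¬OU {v = v} k<n
            (Unmatched-⊆ {v = v} (↾-mono {M} (m<n⇒m<1+n k<n)) (cov v (low-unmatched v u ou))) ou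

        sizes : ∀ k → k ≤ n → size (M ↾ k) ≡ size (N⁺ ↾ k)
        sizes zero _ = ≤-antisym
          (size-mono-≤ id (λ d → contradiction (undefined-at-0 mM) d) λ _ _ → id)
          (size-mono-≤ id (λ d → contradiction (undefined-at-0 m⁺G) d) λ _ _ → id)
        sizes (suc k) k<n = ≤-antisym
          (covering-max (low-matching k<n) (low-¬Del k<n) (low-cover k<n) (proj₁ (below k k<n)))
          (proj₂ (below k k<n) _ (low-matching k<n))

        sigs : ∀ j → 1 ≤ j → j < suc n → sig M j ≡ sig N⁺ j
        sigs (suc j) _ (s≤s j<n) = +-cancelˡ-≡ (size (M ↾ j)) _ _ (begin
          size (M ↾ j) + sig M (suc j)    ≡⟨ size-↾-suc M j ⟨
          size (M ↾ suc j)                ≡⟨ sizes (suc j) j<n ⟩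
          size (N⁺ ↾ suc j)               ≡⟨ size-↾-suc N⁺ j ⟩
          size (N⁺ ↾ j) + sig N⁺ (suc j)  ≡⟨ cong (_+ sig N⁺ (suc j)) (sizes j (<⇒≤ j<n)) ⟨
          size (M ↾ j) + sig N⁺ (suc j)   ∎)
          where open ≡-Reasoning

        all-low : size N⁺ ≤ size (N⁺ ↾ suc n)
        all-low = size-mono-≤ id defined λ _ _ → id
          where
          defined : ∀ {a} → N⁺ a ≢ nothing → (N⁺ ↾ suc n) a ≢ nothing
          defined {a} d e with N⁺ a in e′
          ... | nothing = d refl
          ... | just p = let j , ej , j≤n = Gr-rank n (proj₁ m⁺ a p e′)
                         in case trans (sym e) (trans (sym (cong (keep (suc n) a) e′))
                              (↾-just⁺ {N⁺} e′ (≤-trans (≤-reflexive (rank⇒ρ p ej)) (s≤s j≤n)))) of λ ()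

        top : size (M ↾ n) + sig M (suc n) < size (M ↾ n) + sig N⁺ (suc n)
        top = begin-strict
          size (M ↾ n) + sig M (suc n)    ≡⟨ size-↾-suc M n ⟨
          size N                          <⟨ lt ⟩
          size N⁺                         ≤⟨ all-low ⟩
          size (N⁺ ↾ suc n)               ≡⟨ size-↾-suc N⁺ n ⟩
          size (N⁺ ↾ n) + sig N⁺ (suc n)  ≡⟨ cong (_+ sig N⁺ (suc n)) (sizes n ≤-refl) ⟨
          size (M ↾ n) + sig N⁺ (suc n)   ∎
          where open ≤-Reasoning

      layers-max-step : LayersMax n
      layers-max-step = NoAugmentation⇒max N-matching λ p (N⁺ , m⁺ , lt , cov , _) → no-larger m⁺ lt cov

    layers-max : ∀ n → n ≤ r → LayersMax n
    layers-max = <-rec (λ n → n ≤ r → LayersMax n) λ n below n≤r →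
      layers-max-step n n≤r λ k k<n → below k<n (≤-trans (<⇒≤ k<n) n≤r)

    M-top : ∀ {a p} → M a ≡ just p → (M ↾ suc r) a ≡ just p
    M-top {p = p} e = let j , ej , j≤r = edge-rank mM e in ↾-just⁺ {M} e (≤-trans (≤-reflexive (rank⇒ρ p ej)) (s≤s j≤r))

    rank-maximal⊆Reduced : ∀ {a p} → M a ≡ just p → Reduced a p
    rank-maximal⊆Reduced {a} {p} e = proj₁ (proj₁ (layers-max r ≤-refl)) a p (M-top e) , max⇒¬Del (layers-max r ≤-refl) (M-top e)

    unmatched⇒EvenAll : ∀ {v} → Unmatched M v → EvenAll v
    unmatched⇒EvenAll {v} u k k≤r = Unmatched⇒EvenV {v = v} (layers-max k k≤r) (Unmatched-⊆ {v = v} (↾-⊆ {M}) u)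

  -- Chains and cycles of a partial injection

  module Orbits (φ : Post → Maybe Post)
                (φ-injective : ∀ {p q x} → φ p ≡ just x → φ q ≡ just x → p ≡ q)
                (preimage? : ∀ q → Dec (∃[ p ] φ p ≡ just q)) where

    Step : Post → Post → Set
    Step p q = φ p ≡ just q

    -- Paths are maximal at both ends, which makes orbits closed under `Step` in both directions. A
    -- fixed point of `φ` is a cycle with one vertex; a post with neither image nor preimage is a
    -- path with one vertex.
    data Orbit : Switch → Set where
      path  : ∀ {p ps} → Unique (p ∷ ps) → Linked Step (p ∷ ps) → φ (endpoint p ps) ≡ nothing →
              (∀ q → ¬ Step q p) → Orbit (path (p ∷ ps))
      cycle : ∀ {p ps} → Unique (p ∷ ps) → Linked Step (p ∷ ps) → Step (endpoint p ps) p →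
              Orbit (cycle p ps)

    step-functional : ∀ {p q s} → Step p q → Step p s → q ≡ s
    step-functional e e′ = Maybe.just-injective (trans (sym e) e′)

    linked-successor : ∀ {p ps y z} → Linked Step (p ∷ ps) → y ∈ p ∷ ps → Step y z →
                       y ≡ endpoint p ps ⊎ z ∈ ps
    linked-successor [-] (here refl) _ = inj₁ refl
    linked-successor (s ∷ l) (here refl) s′ = inj₂ (here (step-functional s′ s))
    linked-successor (s ∷ l) (there y∈) s′ with linked-successor l y∈ s′
    ... | inj₁ e  = inj₁ e
    ... | inj₂ z∈ = inj₂ (there z∈)

    linked-consec : ∀ {p ps y z} → Linked Step (p ∷ ps) → y ∈ p ∷ ps → Step y z →
                    y ≡ endpoint p ps ⊎ Consec (p ∷ ps) y z
    linked-consec [-] (here refl) _ = inj₁ refl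
    linked-consec (s ∷ l) (here refl) s′ with step-functional s s′
    ... | refl = inj₂ ([] , _ , refl)
    linked-consec {p} (s ∷ l) (there y∈) s′ with linked-consec l y∈ s′
    ... | inj₁ e = inj₁ e
    ... | inj₂ (ys , zs , e) = inj₂ (p ∷ ys , zs , cong (p ∷_) e)

    linked-predecessor : ∀ {p ps z} → Unique (p ∷ ps) → Linked Step (p ∷ ps) → z ∈ ps →
                         ∃[ y ] (y ∈ p ∷ ps × Step y z × y ≢ endpoint p ps)
    linked-predecessor {p} {q ∷ ps} (p∉ ∷ _) (s ∷ _) (here refl) =
      p , here refl , s , All.lookup p∉ (endpoint-∈ q ps)
    linked-predecessor (_ ∷ u) (_ ∷ l) (there z∈) =
      let y , y∈ , s , ne = linked-predecessor u l z∈ in y , there y∈ , s , ne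

    linked-snoc : ∀ {p ps z} → Linked Step (p ∷ ps) → Step (endpoint p ps) z → Linked Step (p ∷ ps ++ [ z ])
    linked-snoc [-] s = s ∷ [-]
    linked-snoc (s′ ∷ l) s = s′ ∷ linked-snoc l s

    orbit-closed : ∀ {T y z} → Orbit T → y ∈ verts T → Step y z → z ∈ verts T
    orbit-closed (path u l e _) y∈ s with linked-successor l y∈ s
    ... | inj₁ refl = contradiction (trans (sym e) s) λ ()
    ... | inj₂ z∈   = there z∈
    orbit-closed (cycle u l c) y∈ s with linked-successor l y∈ s
    ... | inj₁ refl = here (step-functional s c)
    ... | inj₂ z∈   = there z∈

    orbit-coclosed : ∀ {T y z} → Orbit T → z ∈ verts T → Step y z → y ∈ verts T
    orbit-coclosed (path u l _ src) (here refl) s = contradiction s (src _)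
    orbit-coclosed (path u l _ _) (there z∈) s with linked-predecessor u l z∈
    ... | y , y∈ , s′ , _ = subst (_∈ _) (φ-injective s′ s) y∈
    orbit-coclosed (cycle {p} {ps} u l c) (here refl) s = subst (_∈ _) (φ-injective c s) (endpoint-∈ p ps)
    orbit-coclosed (cycle u l _) (there z∈) s with linked-predecessor u l z∈
    ... | y , y∈ , s′ , _ = subst (_∈ _) (φ-injective s′ s) y∈

    linked-spread : ∀ {C : Post → Set} {p ps x y} → (∀ {q s} → Step q s → C q → C s) →
                    (∀ {q s} → Step q s → C s → C q) → Linked Step (p ∷ ps) →
                    x ∈ p ∷ ps → C x → y ∈ p ∷ ps → C y
    linked-spread {C} fwd bwd l x∈ c = forwards l (backwards l x∈ c)
      where
      backwards : ∀ {p ps x} → Linked Step (p ∷ ps) → x ∈ p ∷ ps → C x → C p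
      backwards _ (here refl) c = c
      backwards (s ∷ l) (there x∈) c = bwd s (backwards l x∈ c)
      forwards : ∀ {p ps y} → Linked Step (p ∷ ps) → C p → y ∈ p ∷ ps → C y
      forwards _ c (here refl) = c
      forwards (s ∷ l) c (there y∈) = forwards l (fwd s c) y∈

    -- Since `T` is closed in both directions, a single common post would spread membership in `T`
    -- along all of `S`, including `x`.
    orbits-disjoint : ∀ {S T x} → Orbit S → Orbit T → x ∈ verts S → x ∉ verts T → VertexDisjoint S T
    orbits-disjoint {T = T} (path _ l _ _) O x∈ x∉ y y∈ y∈T = x∉
      (linked-spread {C = _∈ verts T} (λ s c → orbit-closed O c s) (λ s c → orbit-coclosed O c s) l y∈ y∈T x∈)
    orbits-disjoint {T = T} (cycle _ l _) O x∈ x∉ y y∈ y∈T = x∉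
      (linked-spread {C = _∈ verts T} (λ s c → orbit-closed O c s) (λ s c → orbit-coclosed O c s) l y∈ y∈T x∈)

    allPosts : List Post
    allPosts = map inj₁ (allFin nP) ++ map inj₂ (allFin nA)

    ∈-allPosts : ∀ p → p ∈ allPosts
    ∈-allPosts (inj₁ p) = ∈-++⁺ˡ (∈-map⁺ inj₁ (∈-allFin p))
    ∈-allPosts (inj₂ a) = ∈-++⁺ʳ (map inj₁ (allFin nP)) (∈-map⁺ inj₂ (∈-allFin a))

    bounded : ∀ {A : Set} {ps} → Unique ps → length allPosts < length ps → A
    bounded u lt = contradiction (Unique-⊆⇒length-≤ u (λ _ → ∈-allPosts _)) (<⇒≱ lt)

    _∈ᵖ?_ : ∀ p ps → Dec (p ∈ ps)
    _∈ᵖ?_ = _∈?_ _≟ᵖ_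

    OrbitOf : Post → Set
    OrbitOf x = ∃[ T ] (Orbit T × x ∈ verts T)

    -- The fuel never runs out: there are no duplicate-free lists longer
    -- than allPosts.
    grow-forwards : ∀ fuel {x p ps} → length allPosts < fuel + length (p ∷ ps) → x ∈ p ∷ ps →
                    Unique (p ∷ ps) → Linked Step (p ∷ ps) → (∀ q → ¬ Step q p) → OrbitOf x
    grow-forwards zero lt x∈ u l src = bounded u lt
    grow-forwards (suc fuel) {x} {p} {ps} lt x∈ u l src with φ (endpoint p ps) in e
    ... | nothing = _ , path u l e src , x∈
    ... | just z with z ∈ᵖ? (p ∷ ps)
    ...   | yes (here refl) = contradiction e (src _)
    ...   | yes (there z∈) with linked-predecessor u l z∈
    ...     | y , _ , s , ne = contradiction (φ-injective s e) ne
    grow-forwards (suc fuel) {x} {p} {ps} lt x∈ u l src | just z | no z∉ =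
      grow-forwards fuel (subst (length allPosts <_) lengths lt) (∈-++⁺ˡ x∈)
        (Unique.++⁺ u ([] ∷ []) λ { (z∈ , here refl) → z∉ z∈ }) (linked-snoc l e) src
      where
      lengths : suc fuel + length (p ∷ ps) ≡ fuel + length (p ∷ ps ++ [ z ])
      lengths = trans (sym (+-suc fuel _)) (cong (λ k → fuel + suc k)
        (trans (+-comm 1 (length ps)) (sym (length-++ ps))))

    -- Predecessors are exhausted first. On the way back a repetition can only be the endpoint,
    -- which closes a cycle; forwards from a source, injectivity excludes any repetition.
    grow-backwards : ∀ fuel {x p ps} → length allPosts < fuel + length (p ∷ ps) → x ∈ p ∷ ps →
                     Unique (p ∷ ps) → Linked Step (p ∷ ps) → OrbitOf x
    grow-backwards zero lt x∈ u l = bounded u lt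
    grow-backwards (suc fuel) {x} {p} {ps} lt x∈ u l with preimage? p
    ... | no none = grow-forwards (suc fuel) lt x∈ u l λ q s → none (q , s)
    ... | yes (y , s) with y ∈ᵖ? (p ∷ ps)
    ...   | no y∉ = grow-backwards fuel (subst (length allPosts <_) (sym (+-suc fuel _)) lt) (there x∈)
                      (All.tabulate (λ { z∈ refl → y∉ z∈ }) ∷ u) (s ∷ l)
    ...   | yes y∈ with linked-successor l y∈ s
    ...     | inj₁ refl = _ , cycle u l s , x∈
    ...     | inj₂ p∈ = contradiction p∈ (Unique.Unique[x∷xs]⇒x∉xs u)

    orbit-of : ∀ x → OrbitOf x
    orbit-of x = grow-backwards (suc (length allPosts)) (m≤m+n _ _) (here refl) ([] ∷ []) [-]

    OrbitCover : List Post → Set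
    OrbitCover xs = ∃[ Ts ] (All Orbit Ts × AllPairs VertexDisjoint Ts ×
                             (∀ {x} → x ∈ xs → ∃[ T ] (T ∈ Ts × x ∈ verts T)))

    orbit-cover : ∀ xs → OrbitCover xs
    orbit-cover [] = [] , [] , [] , λ ()
    orbit-cover (x ∷ xs) with orbit-cover xs
    ... | Ts , os , ds , cov with Any.any? (λ T → x ∈ᵖ? verts T) Ts
    ...   | yes found = Ts , os , ds , λ { (here refl) → find found ; (there y∈) → cov y∈ }
    ...   | no none with orbit-of x
    ...     | S , o , x∈ = S ∷ Ts , o ∷ os ,
      All.tabulate (λ T∈ → orbits-disjoint o (All.lookup os T∈) x∈ (λ x∈T → none (lose T∈ x∈T))) ∷ ds ,
      λ { (here refl) → S , here refl , x∈
        ; (there y∈) → let T , T∈ , y∈T = cov y∈ in T , there T∈ , y∈T }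

    orbit-consec : ∀ {T y z} → Orbit T → y ∈ verts T → Step y z → Consec (trace T) y z
    orbit-consec (path u l e _) y∈ s with linked-consec l y∈ s
    ... | inj₁ refl = contradiction (trans (sym e) s) λ ()
    ... | inj₂ c    = c
    orbit-consec {z = z} (cycle {p} {ps} u l c) y∈ s with linked-consec l y∈ s
    ... | inj₂ (ys , zs , e) = ys , zs ++ [ p ] , trans (cong (_++ [ p ]) e) (++-assoc ys _ [ p ])
    ... | inj₁ refl with step-functional c s
    ...   | refl = let ys , e = split p ps in ys , [] , trans (cong (_++ [ p ]) e) (++-assoc ys _ [ p ])
      where
      split : ∀ p ps → ∃[ ys ] p ∷ ps ≡ ys ++ [ endpoint p ps ]
      split p [] = [] , refl
      split p (q ∷ ps) = let ys , e = split q ps in p ∷ ys , cong (p ∷_) e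

  -- Weights of the orbits

  count-single : ∀ {f : Applicant → ℕ} b → (∀ {a} → a ≢ b → f a ≡ 0) → count f ≡ f b
  count-single b = sum-single (Unique.allFin⁺ nA) (∈-allFin b)

  count-* : ∀ c (f : Applicant → ℕ) → count (λ a → c * f a) ≡ c * count f
  count-* c f = go (allFin nA)
    where
    go : ∀ as → sum (map (λ a → c * f a) as) ≡ c * sum (map f as)
    go [] = sym (*-zeroʳ c)
    go (a ∷ as) = trans (cong (c * f a +_) (go as)) (sym (*-distribˡ-+ c (f a) _))

  rank-last-resort : ∀ a → rank a (inj₂ a) ≡ just (suc r)
  rank-last-resort a with a Fin.≟ a
  ... | yes _ = refl
  ... | no ne = contradiction refl ne

  last-resort-private : ∀ {a b i} → rank a (inj₂ b) ≡ just i → a ≡ b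
  last-resort-private {a} {b} e with a Fin.≟ b
  ... | yes a≡b = a≡b
  last-resort-private () | no _

  -- Only `a` can use its last-resort post, so if `a` were unmatched, both would be even on all
  -- levels. Their edge would then lie in `Gr r` and could be added to a maximum matching.
  rank-maximal-total : ∀ {M} → RankMaximal M → ∀ a → ∃[ p ] M a ≡ just p
  rank-maximal-total {M} rM a with M a in e
  ... | just p  = p , refl
  ... | nothing = contradiction (proj₂ mx _ (assign-matching (proj₁ mx) edge free)) (<⇒≱ larger)
    where
    mx : MaxMatching (Gr r) (M ↾ suc r)
    mx = layers-max rM r ≤-refl
    unowned : Unmatched M (inj₂ (inj₂ a))
    unowned b e′ with last-resort-private {b} {a} (proj₂ (proj₁ (proj₁ rM) b _ e′))
    ... | refl = case trans (sym e) e′ of λ ()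
    edge : Gr r a (inj₂ a)
    edge = Gr-enter r (rank-last-resort a) λ k k<r →
      EvenV⇒¬OU (unmatched⇒EvenAll rM {inj₁ a} e k (<⇒≤ k<r)) ,
      EvenV⇒¬OU (unmatched⇒EvenAll rM {inj₂ (inj₂ a)} unowned k (<⇒≤ k<r))
    free : Unmatched (M ↾ suc r) (inj₂ (inj₂ a))
    free b e′ = unowned b (↾-⊆ {M} e′)
    larger : size (M ↾ suc r) < size ((M ↾ suc r) [ a ≔ inj₂ a ])
    larger = size-mono-< id (assign-defined (M ↾ suc r)) (λ _ _ → id) {a}
      (λ e′ → case trans (sym e′) (assigned (M ↾ suc r) a (inj₂ a)) of λ ())
      λ { d refl → d (cong (keep (suc r) a) e) }

  -- The total rank as a function of the signature

  module _ (m : Applicant → Post) where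

    -- These are the partial sums of the rank times the signature entry, as `capped-suc` shows; they
    -- allow an induction over ranks.
    capped : ℕ → ℕ
    capped k = count λ a → if ρ a (m a) ≤ᵇ k then ρ a (m a) else 0

    capped-suc : ∀ k → capped (suc k) ≡ capped k + suc k * sig (just ∘ m) (suc k)
    capped-suc k = trans (count-cong pointwise)
      (trans (count-+ (λ a → if ρ a (m a) ≤ᵇ k then ρ a (m a) else 0) (λ a → suc k * hit (suc k) a (just (m a))))
        (cong (capped k +_) (count-* (suc k) (λ a → hit (suc k) a (just (m a))))))
      where
      layer : ∀ j → (if j ≤ᵇ suc k then j else 0) ≡ (if j ≤ᵇ k then j else 0) + suc k * (if suc k ≡ᵇ j then 1 else 0)
      layer j with <-cmp j (suc k)
      ... | tri< lt ne _ rewrite dec-true (j ≤? suc k) (<⇒≤ lt) | dec-true (j ≤? k) (s≤s⁻¹ lt)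
                               | dec-false (suc k ≟ j) (ne ∘ sym) | *-zeroʳ k = sym (+-identityʳ j)
      ... | tri≈ _ refl _ rewrite dec-true (suc k ≤? suc k) ≤-refl | dec-false (suc k ≤? k) 1+n≰n
                                | dec-true (k ≟ k) refl = sym (*-identityʳ (suc k))
      ... | tri> nlt ne gt rewrite dec-false (j ≤? suc k) (<⇒≱ gt) | dec-false (j ≤? k) (λ le → nlt (s≤s le))
                                 | dec-false (suc k ≟ j) (ne ∘ sym) = sym (*-zeroʳ k)
      pointwise : ∀ a → (if ρ a (m a) ≤ᵇ suc k then ρ a (m a) else 0) ≡
                        (if ρ a (m a) ≤ᵇ k then ρ a (m a) else 0) + suc k * hit (suc k) a (just (m a))
      pointwise a with rank a (m a)
      ... | nothing = sym (*-zeroʳ k)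
      ... | just j  = layer j

    totalRank : ℕ
    totalRank = count λ a → ρ a (m a)

    totalRank-capped : IsMatchingIn EdgesG (just ∘ m) → totalRank ≡ capped (suc r)
    totalRank-capped mm = count-cong λ a → let i , e = proj₁ mm a (m a) refl in
      sym (cong (λ b → if b then ρ a (m a) else 0)
        (dec-true (ρ a (m a) ≤? suc r) (subst (_≤ suc r) (sym (rank⇒ρ (m a) e)) (proj₂ (rank-positive (m a) e)))))

  totalRank-sig : ∀ {m n} → IsMatchingIn EdgesG (just ∘ m) → IsMatchingIn EdgesG (just ∘ n) →
                  (∀ i → 1 ≤ i → i ≤ suc r → sig (just ∘ m) i ≡ sig (just ∘ n) i) →
                  totalRank m ≡ totalRank n
  totalRank-sig {m} {n} mm mn sigs =
    trans (totalRank-capped m mm) (trans (go (suc r) ≤-refl) (sym (totalRank-capped n mn)))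
    where
    capped-zero : ∀ m → capped m 0 ≡ 0
    capped-zero m = sum-zero _ (allFin nA) λ {a} _ → zero-cap (ρ a (m a))
      where
      zero-cap : ∀ j → (if j ≤ᵇ 0 then j else 0) ≡ 0
      zero-cap zero    = refl
      zero-cap (suc j) = refl
    go : ∀ k → k ≤ suc r → capped m k ≡ capped n k
    go zero _ = trans (capped-zero m) (sym (capped-zero n))
    go (suc k) k<  = trans (capped-suc m k) (trans
      (cong₂ _+_ (go k (<⇒≤ k<)) (cong (suc k *_) (sigs (suc k) (s≤s z≤n) k<))) (sym (capped-suc n k)))

  -- By strong induction both pairs agree at all earlier positions, so an excess of `s` over `t` or
  -- of `s′` over `t′` at `i` would be a lexicographic gain. Both inequalities being excluded, the
  -- balance forces equality.
  lex-balance : ∀ {s s′ t t′} → (∀ i → s i + s′ i ≡ t i + t′ i) → ¬ LexLess t s → ¬ LexLess t′ s′ →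
                ∀ i → 1 ≤ i → i ≤ suc r → s i ≡ t i
  lex-balance {s} {s′} {t} {t′} bal ¬lt ¬lt′ = <-rec (λ i → 1 ≤ i → i ≤ suc r → s i ≡ t i) λ i rec 1≤ ≤r →
    let before : ∀ j → 1 ≤ j → j < i → s j ≡ t j
        before j 1≤j j<i = rec j<i 1≤j (≤-trans (<⇒≤ j<i) ≤r)
        before′ : ∀ j → 1 ≤ j → j < i → t′ j ≡ s′ j
        before′ j 1≤j j<i = +-cancelˡ-≡ (t j) _ _
          (trans (sym (bal j)) (cong (_+ s′ j) (before j 1≤j j<i)))
        s≤t : s i ≤ t i
        s≤t = ≮⇒≥ λ lt → ¬lt (i , 1≤ , ≤r , (λ j p q → sym (before j p q)) , lt)
        s′≤t′ : s′ i ≤ t′ i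
        s′≤t′ = ≮⇒≥ λ lt → ¬lt′ (i , 1≤ , ≤r , before′ , lt)
    in ≤-antisym s≤t (+-cancelʳ-≤ (s′ i) _ _ (≤-trans (+-monoʳ-≤ (t i) s′≤t′) (≤-reflexive (sym (bal i)))))

  -- Exchanging two rank-maximal matchings along one orbit

  module Switching (M M′ : Assignment) (rM : RankMaximal M) (rM′ : RankMaximal M′) where

    m m′ : Applicant → Post
    m  a = proj₁ (rank-maximal-total rM a)
    m′ a = proj₁ (rank-maximal-total rM′ a)

    M≡ : ∀ a → M a ≡ just (m a)
    M≡ a = proj₂ (rank-maximal-total rM a)

    M′≡ : ∀ a → M′ a ≡ just (m′ a)
    M′≡ a = proj₂ (rank-maximal-total rM′ a)

    m-injective : ∀ {a b} → m a ≡ m b → a ≡ b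
    m-injective {a} {b} e = proj₂ (proj₁ rM) a b (m a) (M≡ a) (trans (M≡ b) (cong just (sym e)))

    m′-injective : ∀ {a b} → m′ a ≡ m′ b → a ≡ b
    m′-injective {a} {b} e = proj₂ (proj₁ rM′) a b (m′ a) (M′≡ a) (trans (M′≡ b) (cong just (sym e)))

    Owner : Post → Set
    Owner p = ∃[ a ] m a ≡ p

    findOwner : ∀ p → Dec (Owner p)
    findOwner p = any? λ a → m a ≟ᵖ p

    φ : Post → Maybe Post
    φ p with findOwner p
    ... | yes (a , _) = just (m′ a)
    ... | no _        = nothing

    φ-owned : ∀ a → φ (m a) ≡ just (m′ a)
    φ-owned a with findOwner (m a)
    ... | yes (b , e) = cong (just ∘ m′) (m-injective e)
    ... | no none     = contradiction (a , refl) none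

    φ-just : ∀ {p q} → φ p ≡ just q → ∃[ a ] (m a ≡ p × m′ a ≡ q)
    φ-just {p} e with findOwner p
    φ-just refl | yes (a , e) = a , e , refl
    φ-just ()   | no _

    φ-nothing : ∀ {p} → φ p ≡ nothing → ¬ Owner p
    φ-nothing {p} e with findOwner p
    φ-nothing () | yes _
    φ-nothing e | no none = none

    φ-injective : ∀ {p q x} → φ p ≡ just x → φ q ≡ just x → p ≡ q
    φ-injective e₁ e₂ with φ-just e₁ | φ-just e₂
    ... | a , refl , e | b , refl , e′ = cong m (m′-injective (trans e (sym e′)))

    preimage? : ∀ q → Dec (∃[ p ] φ p ≡ just q)
    preimage? q with any? (λ a → m′ a ≟ᵖ q)
    ... | yes (a , refl) = yes (m a , φ-owned a)
    ... | no none = no λ (p , e) → let a , _ , e′ = φ-just e in none (a , e′)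

    open Orbits φ φ-injective preimage? public

    matching-m : IsMatchingIn EdgesG (just ∘ m)
    matching-m = (λ { a _ refl → proj₁ (proj₁ rM) a (m a) (M≡ a) }) ,
                 λ { a b _ refl e → m-injective (Maybe.just-injective (sym e)) }

    -- The value 0 at a post without owner lets the sink of a path count as a summand although no
    -- edge of the path leaves it.
    weightOf : Post → ℤ
    weightOf p with findOwner p
    ... | yes (a , _) = rkZ a (m′ a) ℤ.- rkZ a (m a)
    ... | no _        = ℤ.0ℤ

    weightOf-owned : ∀ a → weightOf (m a) ≡ rkZ a (m′ a) ℤ.- rkZ a (m a)
    weightOf-owned a with findOwner (m a)
    ... | yes (b , e) with refl ← m-injective {b} {a} e = refl
    ... | no none     = contradiction (a , refl) none

    weightOf-unowned : ∀ {p} → ¬ Owner p → weightOf p ≡ ℤ.0ℤ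
    weightOf-unowned {p} none with findOwner p
    ... | yes o = contradiction o none
    ... | no _  = refl

    step⇒SwEdge : ∀ {p q} → Step p q → SwEdge M p q (weightOf p)
    step⇒SwEdge s with φ-just s
    ... | a , refl , refl = a , M≡ a , rank-maximal⊆Reduced rM′ (M′≡ a) , weightOf-owned a

    pathWeight : Post → List Post → ℤ
    pathWeight p []       = ℤ.0ℤ
    pathWeight p (q ∷ qs) = weightOf p ℤ.+ pathWeight q qs

    -- Summing over vertices instead of edges treats paths and cycles alike, and `totalWeight-over`
    -- can turn the result into sums over applicants.
    totalWeight : List Post → ℤ
    totalWeight []       = ℤ.0ℤ
    totalWeight (p ∷ ps) = weightOf p ℤ.+ totalWeight ps

    linked⇒WPath : ∀ {p ps} → Linked Step (p ∷ ps) → WPath M (p ∷ ps) (pathWeight p ps)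
    linked⇒WPath [-]     = single
    linked⇒WPath (s ∷ l) = cons (step⇒SwEdge s) (linked⇒WPath l)

    pathWeight-snoc : ∀ p ps z → pathWeight p (ps ++ [ z ]) ≡ totalWeight (p ∷ ps)
    pathWeight-snoc p [] z = refl
    pathWeight-snoc p (q ∷ ps) z = cong (λ w → weightOf p ℤ.+ w) (pathWeight-snoc q ps z)

    pathWeight-sink : ∀ p ps → ¬ Owner (endpoint p ps) → pathWeight p ps ≡ totalWeight (p ∷ ps)
    pathWeight-sink p [] none = sym (trans (ℤ.+-identityʳ (weightOf p)) (weightOf-unowned none))
    pathWeight-sink p (q ∷ ps) none = cong (λ w → weightOf p ℤ.+ w) (pathWeight-sink q ps none)

    over : List Post → (Applicant → ℕ) → ℕ
    over ps f = count λ a → if does (m a ∈ᵖ? ps) then f a else 0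

    over-cons : ∀ {p ps} (f : Applicant → ℕ) → p ∉ ps →
                over (p ∷ ps) f ≡ count (λ a → if does (m a ≟ᵖ p) then f a else 0) + over ps f
    over-cons {p} {ps} f p∉ = trans (count-cong pointwise) (count-+ _ (λ a → if does (m a ∈ᵖ? ps) then f a else 0))
      where
      pointwise : ∀ a → (if does (m a ∈ᵖ? (p ∷ ps)) then f a else 0) ≡
                        (if does (m a ≟ᵖ p) then f a else 0) + (if does (m a ∈ᵖ? ps) then f a else 0)
      pointwise a with m a ≟ᵖ p
      ... | no _ = refl
      ... | yes refl rewrite dec-false (m a ∈ᵖ? ps) p∉ = sym (+-identityʳ (f a))

    at-owned : ∀ (f : Applicant → ℕ) b → count (λ a → if does (m a ≟ᵖ m b) then f a else 0) ≡ f b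
    at-owned f b = trans (count-single b λ {a} ne → cong (λ c → if c then f a else 0)
                            (dec-false (m a ≟ᵖ m b) (ne ∘ m-injective)))
                         (cong (λ c → if c then f b else 0) (dec-true (m b ≟ᵖ m b) refl))

    at-unowned : ∀ (f : Applicant → ℕ) {p} → ¬ Owner p → count (λ a → if does (m a ≟ᵖ p) then f a else 0) ≡ 0
    at-unowned f {p} none = sum-zero _ (allFin nA) λ {a} _ → cong (λ c → if c then f a else 0)
                              (dec-false (m a ≟ᵖ p) λ e → none (a , e))

    new old : Applicant → ℕ
    new a = ρ a (m′ a)
    old a = ρ a (m a)

    totalWeight-over : ∀ {ps} → Unique ps → totalWeight ps ≡ ℤ.+ over ps new ℤ.- ℤ.+ over ps old
    totalWeight-over {[]} [] = sym (ℤ.+-inverseʳ (ℤ.+ over [] old))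
    totalWeight-over {p ∷ ps} (p∉ ∷ u) with findOwner p
    ... | yes (b , refl) = begin
      (ℤ.+ new b ℤ.- ℤ.+ old b) ℤ.+ totalWeight ps
        ≡⟨ cong (λ w → (ℤ.+ new b ℤ.- ℤ.+ old b) ℤ.+ w) (totalWeight-over u) ⟩
      (ℤ.+ new b ℤ.- ℤ.+ old b) ℤ.+ (ℤ.+ over ps new ℤ.- ℤ.+ over ps old)
        ≡⟨ ℤ-interchange (ℤ.+ new b) (ℤ.- ℤ.+ old b) (ℤ.+ over ps new) (ℤ.- ℤ.+ over ps old) ⟩
      ℤ.+ (new b + over ps new) ℤ.+ (ℤ.- ℤ.+ old b ℤ.+ ℤ.- ℤ.+ over ps old)
        ≡⟨ cong (λ w → ℤ.+ (new b + over ps new) ℤ.+ w) (ℤ.neg-distrib-+ (ℤ.+ old b) (ℤ.+ over ps old)) ⟨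
      ℤ.+ (new b + over ps new) ℤ.- ℤ.+ (old b + over ps old)
        ≡⟨ cong₂ (λ k l → ℤ.+ k ℤ.- ℤ.+ l) (added new) (added old) ⟨
      ℤ.+ over (m b ∷ ps) new ℤ.- ℤ.+ over (m b ∷ ps) old ∎
      where
      open ≡-Reasoning
      added : ∀ f → over (m b ∷ ps) f ≡ f b + over ps f
      added f = trans (over-cons f (λ p∈ → All.lookup p∉ p∈ refl)) (cong (_+ over ps f) (at-owned f b))
    ... | no none = trans (ℤ.+-identityˡ (totalWeight ps))
      (trans (totalWeight-over u) (sym (cong₂ (λ k l → ℤ.+ k ℤ.- ℤ.+ l) (skipped new) (skipped old))))
      where
      skipped : ∀ f → over (p ∷ ps) f ≡ over ps f
      skipped f = trans (over-cons f (λ p∈ → All.lookup p∉ p∈ refl)) (cong (_+ over ps f) (at-unowned f none))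

    module _ {T : Switch} (o : Orbit T) where

      private
        ps : List Post
        ps = verts T

      pick : Bool → Applicant → Post
      pick b a = if b then m′ a else m a

      inside : Applicant → Bool
      inside a = does (m a ∈ᵖ? ps)

      switched switched′ : Applicant → Post
      switched  a = pick (inside a) a
      switched′ a = pick (not (inside a)) a

      pick-edge : ∀ b a → EdgesG a (pick b a)
      pick-edge true  a = proj₁ (proj₁ rM′) a (m′ a) (M′≡ a)
      pick-edge false a = proj₁ (proj₁ rM) a (m a) (M≡ a)

      -- The hypothesis is a step of `φ` from `m a` to `m b`, and an orbit contains both ends of a
      -- step or neither.
      inside-step : ∀ {a b} → m′ a ≡ m b → inside a ≡ inside b
      inside-step {a} {b} e = go (m a ∈ᵖ? ps) (m b ∈ᵖ? ps)
        where
        s : Step (m a) (m b)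
        s = trans (φ-owned a) (cong just e)
        go : ∀ (a? : Dec (m a ∈ ps)) (b? : Dec (m b ∈ ps)) → does a? ≡ does b?
        go (yes _) (yes _) = refl
        go (no _) (no _) = refl
        go (yes a∈) (no b∉) = contradiction (orbit-closed o a∈ s) b∉
        go (no a∉) (yes b∈) = contradiction (orbit-coclosed o b∈ s) a∉

      -- `g` is `id` for `switched` and `not` for `switched′`. A clash within `m` or within `m′` is
      -- excluded by their injectivity, a mixed one by `inside-step`.
      pick-injective : ∀ {a b} (g : Bool → Bool) →
                       pick (g (inside a)) a ≡ pick (g (inside b)) b → a ≡ b
      pick-injective {a} {b} g e with g (inside a) in ea | g (inside b) in eb
      ... | true  | true  = m′-injective e
      ... | false | false = m-injective e
      ... | true  | false = contradiction (trans (sym ea) (trans (cong g (inside-step e)) eb)) λ ()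
      ... | false | true  = contradiction (trans (sym eb) (trans (cong g (inside-step (sym e))) ea)) λ ()

      matching-switched : IsMatchingIn EdgesG (just ∘ switched)
      matching-switched = (λ { a _ refl → pick-edge (inside a) a }) ,
        λ a b p e e′ → pick-injective id (Maybe.just-injective (trans e (sym e′)))

      matching-switched′ : IsMatchingIn EdgesG (just ∘ switched′)
      matching-switched′ = (λ { a _ refl → pick-edge (not (inside a)) a }) ,
        λ a b p e e′ → pick-injective not (Maybe.just-injective (trans e (sym e′)))

      pick-balance : ∀ b (f : Applicant → Post → ℕ) a →
                     f a (pick b a) + f a (pick (not b) a) ≡ f a (m a) + f a (m′ a)
      pick-balance true  f a = +-comm (f a (m′ a)) (f a (m a))
      pick-balance false f a = refl

      balance : ∀ i → sig (just ∘ switched) i + sig (just ∘ switched′) i ≡ sig M i + sig M′ i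
      balance i = trans (sym (count-+ (λ a → hit i a (just (switched a))) (λ a → hit i a (just (switched′ a)))))
        (trans (count-cong λ a → trans (pick-balance (inside a) (λ a p → hit i a (just p)) a)
                 (sym (cong₂ (λ x y → hit i a x + hit i a y) (M≡ a) (M′≡ a))))
               (count-+ (λ a → hit i a (M a)) (λ a → hit i a (M′ a))))

      sig-switched : ∀ i → 1 ≤ i → i ≤ suc r → sig (just ∘ switched) i ≡ sig (just ∘ m) i
      sig-switched i 1≤ ≤r =
        trans (lex-balance balance (proj₂ rM _ matching-switched) (proj₂ rM′ _ matching-switched′) i 1≤ ≤r)
              (count-cong λ a → cong (hit i a) (M≡ a))

      -- `switched` and `m` have the same total rank and differ only inside the orbit. Adding the
      -- opposite inside part to each gives equal sums, which avoids subtraction of natural numbers.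
      over-balance : over ps new ≡ over ps old
      over-balance = +-cancelˡ-≡ (totalRank m) _ _ (begin
        totalRank m + over ps new         ≡⟨ count-+ old (λ a → if inside a then new a else 0) ⟨
        count (λ a → old a + (if inside a then new a else 0))
          ≡⟨ count-cong (λ a → exchange (inside a) a) ⟩
        count (λ a → ρ a (switched a) + (if inside a then old a else 0))
          ≡⟨ count-+ (λ a → ρ a (switched a)) (λ a → if inside a then old a else 0) ⟩
        totalRank switched + over ps old  ≡⟨ cong (_+ over ps old) (totalRank-sig matching-switched matching-m sig-switched) ⟩
        totalRank m + over ps old         ∎)
        where
        open ≡-Reasoning
        exchange : ∀ b a → old a + (if b then new a else 0) ≡ ρ a (pick b a) + (if b then old a else 0)
        exchange true  a = +-comm (old a) (new a)
        exchange false a = refl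

      weight-zero : Unique ps → totalWeight ps ≡ ℤ.0ℤ
      weight-zero u = trans (totalWeight-over u)
        (trans (cong (λ k → ℤ.+ k ℤ.- ℤ.+ over ps old) over-balance) (ℤ.+-inverseʳ (ℤ.+ over ps old)))

    orbit⇒switching : ∀ {T} → Orbit T → IsSwitching M T
    orbit⇒switching o@(path {p} {ps} u l e _) =
      p , ps , refl , u ,
      subst (WPath M (p ∷ ps)) (trans (pathWeight-sink p ps none) (weight-zero o u)) (linked⇒WPath l) ,
      (λ (q , w , a , e′ , _) → free a e′) , unmatched⇒EvenAll rM {inj₂ (endpoint p ps)} free
      where
      none : ¬ Owner (endpoint p ps)
      none = φ-nothing e
      free : ∀ a → M a ≢ just (endpoint p ps)
      free a e′ = none (a , Maybe.just-injective (trans (sym (M≡ a)) e′))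
    orbit⇒switching o@(cycle {p} {ps} u l c) =
      u , subst (WPath M (p ∷ ps ++ [ p ])) (trans (pathWeight-snoc p ps p) (weight-zero o u))
            (linked⇒WPath (linked-snoc l c))

    decomposition : ∃[ Ts ] (All (IsSwitching M) Ts × AllPairs VertexDisjoint Ts × Applied M Ts M′)
    decomposition =
      let Ts , os , ds , cov = orbit-cover allPosts
      in Ts , All.map orbit⇒switching os , ds , λ a →
        let T , T∈ , a∈ = cov (∈-allPosts (m a))
        -- The orbits cover all posts, so every applicant lies on some switch; one that keeps its
        -- post does so on a cycle with one vertex.
        in inj₁ (T , m a , m′ a , T∈ , M≡ a , orbit-consec (All.lookup os T∈) a∈ (φ-owned a) , M′≡ a)

theorem1 : (G : Instance) → let open Inst G in
    (M M' : Assignment) → RankMaximal M → RankMaximal M' →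
    ∃[ Ts ] (All (IsSwitching M) Ts × AllPairs VertexDisjoint Ts × Applied M Ts M')
theorem1 G M M' rM rM' = Matchings.Switching.decomposition G M M' rM rM'
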